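{- Let $T$ be a first-order theory. Then $T$ is rosy if and only if thorn-forking in $T$ satisfies local character.
   Context: We work in a monster model $\mathcal C^{eq}$ of $T$; tuples may be tuples of imaginaries. Strong dividing: a formula $\delta(x,a)$ strongly divides over $A$ if $tp(a/A)$ is non-algebraic and $\{\delta(x,a')\}_{a'\models tp(a/A)}$ is $k$-inconsistent for some $k\in\mathbb N$. Thorn-dividing (written þ-dividing): $\delta(x,a)$ thorn-divides over $A$ if there is a tuple $c$ such that $\delta(x,a)$ strongly divides over $Ac$. Thorn-forking: a formula thorn-forks over $A$ if it implies a finite disjunction of formulas each of which thorn-divides over $A$; a type thorn-divides (thorn-forks) over $A$ if it contains (implies) a formula that does. Thorn-rank: given a formula $\phi$, a finite set $\Delta$ of formulas in variables $x;y$, a finite set $\Pi$ of formulas in variables $y;z$ ($z$ possibly of infinite length), and a number $k$, define $\operatorname{th}(\phi,\Delta,\Pi,k)$ inductively: (1) it is $\ge 0$ if $\phi$ is consistent; (2) for $\lambda$ limit it is $\ge\lambda$ iff it is $\ge\alpha$ for all $\alpha<\lambda$; (3) it is $\ge\alpha+1$ iff there are $\delta\in\Delta$, $\pi(y;z)\in\Pi$ and parameters $c$ such that (a) $\operatorname{th}(\phi\wedge\delta(x,a),\Delta,\Pi,k)\ge\alpha$ for infinitely many $a\models\pi(y;c)$, and (b) $\{\delta(x,a)\}_{a\models\pi(y;c)}$ is $k$-inconsistent. A theory is rosy if all of its thorn-ranks are defined (i.e. ordinal-valued). Local character of thorn-forking: for every complete type $p$ (in a finite tuple of variables) over a set $A$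 there is $A_0\subseteq A$ with $|A_0|\le|T|$ such that $p$ does not thorn-fork over $A_0$. -}

module Defs where

open import Level using (Level; 0ℓ)
open import Data.Empty using (⊥-elim-irr)
import Data.Empty as Empty
open import Data.Fin.Base using (Fin)
open import Data.List.Base using (List; []; _∷_; map)
open import Data.List.Membership.Propositional using (_∈_)
open import Data.List.Membership.Propositional.Properties using (∈-map⁺)
open import Data.List.Relation.Unary.All using (All; []; _∷_)
open import Data.List.Relation.Unary.Any using (Any; here; there)
open import Data.Nat.Base using (ℕ)
open import Data.Product.Base using (Σ; Σ-syntax; ∃; ∃-syntax; _×_; _,_; proj₁; proj₂)
open import Data.Sum.Base using (_⊎_; inj₁; inj₂; [_,_])
open import Function.Base using (_∘_)
open import Function.Bundles using (Inverse; _↣_)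
open import Relation.Binary.Bundles using (Setoid)
open import Relation.Binary.Definitions using (Reflexive; Symmetric; Transitive)
open import Relation.Binary.PropositionalEquality using (_≡_; refl)
open import Relation.Nullary.Negation using (¬_)
open import Relation.Unary using (Pred)

1ℓ : Level
1ℓ = Level.suc 0ℓ

------------------------------------------------------------------------
-- Logic is many-sorted because the imaginaries need it.  A one-sorted
-- language is one whose Sort is the unit type.

record Language : Set₁ where
  field
    Sort : Set
    Fun  : List Sort → Sort → Set
    Rel  : List Sort → Set

module Syntax (L : Language) where
  open Language L public

  -- A context is a sort-indexed set of variables, possibly infinite.
  -- It serves both for tuples of variables and for small sets of
  -- parameters (a context together with a valuation).

  Ctx : Set₁
  Ctx = Sort → Set

  ⟨_⟩ : List Sort → Ctx
  ⟨ w ⟩ s = s ∈ w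

  ∅ : Ctx
  ∅ _ = Empty.⊥

  infixl 6 _⊕_ _▹_
  _⊕_ : Ctx → Ctx → Ctx
  (Γ ⊕ Δ) s = Γ s ⊎ Δ s

  _▹_ : Ctx → Sort → Ctx
  Γ ▹ s = Γ ⊕ (_≡ s)

  data Term (Γ : Ctx) : Sort → Set where
    var : ∀ {s} → Γ s → Term Γ s
    app : ∀ {w s} → Fun w s → All (Term Γ) w → Term Γ s

  -- The remaining connectives are classically definable from these.

  infixr 5 _⇒_
  infixr 6 _∧_
  data Formula (Γ : Ctx) : Set where
    ⊥ᶠ  : Formula Γ
    _≐_ : ∀ {s} → Term Γ s → Term Γ s → Formula Γ
    rel : ∀ {w} → Rel w → All (Term Γ) w → Formula Γ
    _∧_ : Formula Γ → Formula Γ → Formula Γ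
    _⇒_ : Formula Γ → Formula Γ → Formula Γ
    all : (s : Sort) → Formula (Γ ▹ s) → Formula Γ

  ~_ : ∀ {Γ} → Formula Γ → Formula Γ
  ~ φ = φ ⇒ ⊥ᶠ

  Sentence : Set
  Sentence = Formula ∅

  Ren : Ctx → Ctx → Set
  Ren Γ Δ = ∀ s → Γ s → Δ s

  lift : ∀ {Γ Δ s} → Ren Γ Δ → Ren (Γ ▹ s) (Δ ▹ s)
  lift ρ t (inj₁ v) = inj₁ (ρ t v)
  lift ρ t (inj₂ e) = inj₂ e

  mutual
    renᵗ : ∀ {Γ Δ s} → Ren Γ Δ → Term Γ s → Term Δ s
    renᵗ ρ (var v)    = var (ρ _ v)
    renᵗ ρ (app f ts) = app f (renᵗˢ ρ ts)

    renᵗˢ : ∀ {Γ Δ w} → Ren Γ Δ → All (Term Γ) w → All (Term Δ) w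
    renᵗˢ ρ []       = []
    renᵗˢ ρ (t ∷ ts) = renᵗ ρ t ∷ renᵗˢ ρ ts

  ren : ∀ {Γ Δ} → Ren Γ Δ → Formula Γ → Formula Δ
  ren ρ ⊥ᶠ         = ⊥ᶠ
  ren ρ (t ≐ u)    = renᵗ ρ t ≐ renᵗ ρ u
  ren ρ (rel r ts) = rel r (renᵗˢ ρ ts)
  ren ρ (φ ∧ ψ)    = ren ρ φ ∧ ren ρ ψ
  ren ρ (φ ⇒ ψ)    = ren ρ φ ⇒ ren ρ ψ
  ren ρ (all s φ)  = all s (ren (lift ρ) φ)

  unpack[] : ∀ {Γ} → Ren (Γ ⊕ ⟨ [] ⟩) Γ
  unpack[] _ (inj₁ v) = v

  unpack∷ : ∀ {Γ s w} → Ren (Γ ⊕ ⟨ s ∷ w ⟩) (Γ ▹ s ⊕ ⟨ w ⟩)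
  unpack∷ _ (inj₁ v)         = inj₁ (inj₁ v)
  unpack∷ _ (inj₂ (here e))  = inj₁ (inj₂ e)
  unpack∷ _ (inj₂ (there i)) = inj₂ i

  alls : ∀ {Γ} (w : List Sort) → Formula (Γ ⊕ ⟨ w ⟩) → Formula Γ
  alls []      φ = ren unpack[] φ
  alls (s ∷ w) φ = all s (alls w (ren unpack∷ φ))

  -- The sentence "E is an equivalence relation on w-tuples".

  reflᶠ symᶠ transᶠ equivᶠ : (w : List Sort) → Formula (⟨ w ⟩ ⊕ ⟨ w ⟩) → Sentence
  reflᶠ  w E = alls w (ren (λ _ → [ inj₂ , inj₂ ]) E)
  symᶠ   w E = alls w (alls w (ren (λ _ → [ inj₁ ∘ inj₂ , inj₂ ]) E
                             ⇒ ren (λ _ → [ inj₂ , inj₁ ∘ inj₂ ]) E))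
  transᶠ w E = alls w (alls w (alls w (ren (λ _ → [ inj₁ ∘ inj₁ ∘ inj₂ , inj₁ ∘ inj₂ ]) E
                                     ⇒ ren (λ _ → [ inj₁ ∘ inj₂ , inj₂ ]) E
                                     ⇒ ren (λ _ → [ inj₁ ∘ inj₁ ∘ inj₂ , inj₂ ]) E)))
  equivᶠ w E = reflᶠ w E ∧ symᶠ w E ∧ transᶠ w E

Theory : Language → Set₁
Theory L = Pred (Syntax.Sentence L) 0ℓ

Complete : (L : Language) → Theory L → Set
Complete L T = ∀ σ → T σ ⊎ T (~ σ)
  where open Syntax L

-- |T| is, as usual, the number of formulas of its language: |L| + ℵ₀.

FormulasOf : Language → Set
FormulasOf L = Σ[ w ∈ List Sort ] Formula ⟨ w ⟩
  where open Syntax L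

-- Universes measure size: languages, contexts and parameter sets live in
-- Set ("small"), whereas the carriers of a structure live in Set₁.
-- Equality in a structure is a setoid equality so that sorts of
-- equivalence classes can be formed.

record Structure (L : Language) : Set₂ where
  open Syntax L
  field
    Dom : Sort → Setoid 1ℓ 1ℓ

  module Dom (s : Sort) = Setoid (Dom s)

  Val : Ctx → Set₁
  Val Γ = ∀ s → Γ s → Dom.Carrier s

  infix 4 _≈ᵛ_
  _≈ᵛ_ : ∀ {Γ} → Val Γ → Val Γ → Set₁
  _≈ᵛ_ {Γ} a b = ∀ s (v : Γ s) → Dom._≈_ s (a s v) (b s v)

  field
    ⟦_⟧ᶠ     : ∀ {w s} → Fun w s → Val ⟨ w ⟩ → Dom.Carrier s
    ⟦_⟧ᶠ-cong : ∀ {w s} (f : Fun w s) {a b : Val ⟨ w ⟩} →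
                a ≈ᵛ b → Dom._≈_ s (⟦ f ⟧ᶠ a) (⟦ f ⟧ᶠ b)
    ⟦_⟧ʳ     : ∀ {w} → Rel w → Pred (Val ⟨ w ⟩) 1ℓ
    ⟦_⟧ʳ-cong : ∀ {w} (r : Rel w) {a b : Val ⟨ w ⟩} →
                a ≈ᵛ b → ⟦ r ⟧ʳ a → ⟦ r ⟧ʳ b

module Semantics {L : Language} (M : Structure L) where
  open Syntax L public
  open Structure M public

  infixl 5 _&_
  _&_ : ∀ {Γ Δ} → Val Γ → Val Δ → Val (Γ ⊕ Δ)
  (a & b) s (inj₁ v) = a s v
  (a & b) s (inj₂ v) = b s v

  single : ∀ {s} → Dom.Carrier s → Val (_≡ s)
  single x _ refl = x

  empty : Val ∅
  empty _ ()

  mutual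
    eval : ∀ {Γ s} → Val Γ → Term Γ s → Dom.Carrier s
    eval a (var v)    = a _ v
    eval a (app f ts) = ⟦ f ⟧ᶠ (evals a ts)

    evals : ∀ {Γ w} → Val Γ → All (Term Γ) w → Val ⟨ w ⟩
    evals a (t ∷ ts) _ (here refl) = eval a t
    evals a (t ∷ ts) _ (there i)   = evals a ts _ i

  infix 4 _⊨_
  _⊨_ : ∀ {Γ} → Val Γ → Formula Γ → Set₁
  a ⊨ ⊥ᶠ       = Level.Lift 1ℓ Empty.⊥
  a ⊨ (_≐_ {s} t u) = Dom._≈_ s (eval a t) (eval a u)
  a ⊨ rel r ts = ⟦ r ⟧ʳ (evals a ts)
  a ⊨ φ ∧ ψ    = (a ⊨ φ) × (a ⊨ ψ)
  a ⊨ φ ⇒ ψ    = a ⊨ φ → a ⊨ ψ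
  a ⊨ all s φ  = ∀ (x : Dom.Carrier s) → a & single x ⊨ φ

  Models : Theory L → Set₁
  Models T = ∀ σ → T σ → empty ⊨ σ

  -- Truth is invariant under renaming and under ≈ᵛ.

  _≈[_]_ : ∀ {Γ Δ} → Val Γ → Ren Γ Δ → Val Δ → Set₁
  _≈[_]_ {Γ} a ρ b = ∀ s (v : Γ s) → Dom._≈_ s (a s v) (b s (ρ s v))

  mutual
    eval-ren : ∀ {Γ Δ s} {a : Val Γ} {b : Val Δ} (ρ : Ren Γ Δ) → a ≈[ ρ ] b →
               (t : Term Γ s) → Dom._≈_ s (eval a t) (eval b (renᵗ ρ t))
    eval-ren ρ e (var v)    = e _ v
    eval-ren ρ e (app f ts) = ⟦ f ⟧ᶠ-cong (evals-ren ρ e ts)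

    evals-ren : ∀ {Γ Δ w} {a : Val Γ} {b : Val Δ} (ρ : Ren Γ Δ) → a ≈[ ρ ] b →
                (ts : All (Term Γ) w) → evals a ts ≈ᵛ evals b (renᵗˢ ρ ts)
    evals-ren ρ e (t ∷ ts) _ (here refl) = eval-ren ρ e t
    evals-ren ρ e (t ∷ ts) _ (there i)   = evals-ren ρ e ts _ i

  lift-≈ : ∀ {Γ Δ s} {a : Val Γ} {b : Val Δ} (ρ : Ren Γ Δ) → a ≈[ ρ ] b →
           (x : Dom.Carrier s) → (a & single x) ≈[ lift ρ ] (b & single x)
  lift-≈ ρ e x t (inj₁ v)    = e t v
  lift-≈ ρ e x t (inj₂ refl) = Dom.refl t

  ⊨-ren⁺ : ∀ {Γ Δ} {a : Val Γ} {b : Val Δ} (ρ : Ren Γ Δ) → a ≈[ ρ ] b →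
           ∀ φ → a ⊨ φ → b ⊨ ren ρ φ
  ⊨-ren⁻ : ∀ {Γ Δ} {a : Val Γ} {b : Val Δ} (ρ : Ren Γ Δ) → a ≈[ ρ ] b →
           ∀ φ → b ⊨ ren ρ φ → a ⊨ φ
  ⊨-ren⁺ ρ e (_≐_ {s} t u) h =
    Dom.trans s (Dom.sym s (eval-ren ρ e t)) (Dom.trans s h (eval-ren ρ e u))
  ⊨-ren⁺ ρ e (rel r ts) h = ⟦ r ⟧ʳ-cong (evals-ren ρ e ts) h
  ⊨-ren⁺ ρ e (φ ∧ ψ) (h , k) = ⊨-ren⁺ ρ e φ h , ⊨-ren⁺ ρ e ψ k
  ⊨-ren⁺ ρ e (φ ⇒ ψ) h k = ⊨-ren⁺ ρ e ψ (h (⊨-ren⁻ ρ e φ k))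
  ⊨-ren⁺ ρ e (all s φ) h x = ⊨-ren⁺ (lift ρ) (lift-≈ ρ e x) φ (h x)
  ⊨-ren⁻ ρ e (_≐_ {s} t u) h =
    Dom.trans s (eval-ren ρ e t) (Dom.trans s h (Dom.sym s (eval-ren ρ e u)))
  ⊨-ren⁻ ρ e (rel r ts) h =
    ⟦ r ⟧ʳ-cong (λ s i → Dom.sym s (evals-ren ρ e ts s i)) h
  ⊨-ren⁻ ρ e (φ ∧ ψ) (h , k) = ⊨-ren⁻ ρ e φ h , ⊨-ren⁻ ρ e ψ k
  ⊨-ren⁻ ρ e (φ ⇒ ψ) h k = ⊨-ren⁻ ρ e ψ (h (⊨-ren⁺ ρ e φ k))
  ⊨-ren⁻ ρ e (all s φ) h x = ⊨-ren⁻ (lift ρ) (lift-≈ ρ e x) φ (h x)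

  alls-elim : ∀ {Γ} {a : Val Γ} w (φ : Formula (Γ ⊕ ⟨ w ⟩)) →
              a ⊨ alls w φ → ∀ b → a & b ⊨ φ
  alls-elim {Γ} {a} [] φ h b = ⊨-ren⁻ unpack[] e φ h
    where
    e : (a & b) ≈[ unpack[] ] a
    e s (inj₁ v) = Dom.refl s
  alls-elim {Γ} {a} (s ∷ w) φ h b =
    ⊨-ren⁻ unpack∷ e φ (alls-elim w _ (h (b s (here refl))) tail)
    where
    tail : Val ⟨ w ⟩
    tail t i = b t (there i)
    e : (a & b) ≈[ unpack∷ ] (a & single (b s (here refl)) & tail)
    e t (inj₁ v)           = Dom.refl t
    e t (inj₂ (here refl)) = Dom.refl t
    e t (inj₂ (there i))   = Dom.refl t

  module _ (w : List Sort) (E : Formula (⟨ w ⟩ ⊕ ⟨ w ⟩))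
           (h : empty ⊨ equivᶠ w E) where

    private
      _~ᴱ_ : Val ⟨ w ⟩ → Val ⟨ w ⟩ → Set₁
      a ~ᴱ b = a & b ⊨ E

    equiv-refl : Reflexive _~ᴱ_
    equiv-refl {a} = ⊨-ren⁻ _ (λ { s (inj₁ _) → Dom.refl s ; s (inj₂ _) → Dom.refl s }) E
      (alls-elim w _ (proj₁ h) a)

    equiv-sym : Symmetric _~ᴱ_
    equiv-sym {a} {b} k =
      ⊨-ren⁻ _ (λ { s (inj₁ _) → Dom.refl s ; s (inj₂ _) → Dom.refl s }) E
      (alls-elim w _ (alls-elim w _ (proj₁ (proj₂ h)) a) b
        (⊨-ren⁺ _ (λ { s (inj₁ _) → Dom.refl s ; s (inj₂ _) → Dom.refl s }) E k))

    equiv-trans : Transitive _~ᴱ_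
    equiv-trans {a} {b} {c} k l =
      ⊨-ren⁻ _ (λ { s (inj₁ _) → Dom.refl s ; s (inj₂ _) → Dom.refl s }) E
      (alls-elim w _ (alls-elim w _ (alls-elim w _ (proj₂ (proj₂ h)) a) b) c
        (⊨-ren⁺ _ (λ { s (inj₁ _) → Dom.refl s ; s (inj₂ _) → Dom.refl s }) E k)
        (⊨-ren⁺ _ (λ { s (inj₁ _) → Dom.refl s ; s (inj₂ _) → Dom.refl s }) E l))

    equiv-≈ᵛ : ∀ {a b} → a ≈ᵛ b → a ~ᴱ b
    equiv-≈ᵛ {a} {b} e =
      ⊨-ren⁻ _ (λ { s (inj₁ v) → e s v ; s (inj₂ _) → Dom.refl s }) E
      (alls-elim w _ (proj₁ h) b)

------------------------------------------------------------------------
-- Types and monster models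

module Types {L : Language} (M : Structure L) where
  open Semantics M public

  Tuple : List Sort → Set₁
  Tuple w = Val ⟨ w ⟩

  Partial : Ctx → Ctx → Set₂
  Partial Γ A = Pred (Formula (Γ ⊕ A)) 1ℓ

  module _ {Γ A : Ctx} (p : Partial Γ A) (a : Val A) where

    Realizes : Val Γ → Set₁
    Realizes b = ∀ φ → p φ → b & a ⊨ φ

    FinitelySatisfiable : Set₁
    FinitelySatisfiable = ∀ φs → All p φs → ∃[ b ] All (λ φ → b & a ⊨ φ) φs

    record CompleteType : Set₁ where
      field
        consistent : FinitelySatisfiable
        complete   : ∀ φ → p φ ⊎ p (~ φ)

  tp : ∀ {Γ A} → Val Γ → Val A → Partial Γ A
  tp b a φ = b & a ⊨ φ

  record Automorphism : Set₁ where
    field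
      iso : ∀ s → Inverse (Dom s) (Dom s)

    apply : ∀ {Γ} → Val Γ → Val Γ
    apply a s v = Inverse.to (iso s) (a s v)

    field
      preserves-fun : ∀ {w s} (f : Fun w s) (a : Tuple w) →
                      Dom._≈_ s (Inverse.to (iso s) (⟦ f ⟧ᶠ a)) (⟦ f ⟧ᶠ (apply a))
      preserves-rel : ∀ {w} (r : Rel w) (a : Tuple w) → ⟦ r ⟧ʳ a → ⟦ r ⟧ʳ (apply a)
      reflects-rel  : ∀ {w} (r : Rel w) (a : Tuple w) → ⟦ r ⟧ʳ (apply a) → ⟦ r ⟧ʳ a

  -- "Small" is "indexed by a context", i.e. by types in Set; the monster
  -- model itself may be large.

  record Monster : Set₂ where
    field
      saturated   : ∀ {Γ A : Ctx} (a : Val A) (p : Partial Γ A) →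
                    FinitelySatisfiable p a → ∃[ b ] Realizes p a b
      homogeneous : ∀ {Γ : Ctx} (a b : Val Γ) →
                    (∀ φ → a ⊨ φ → b ⊨ φ) →
                    Σ[ σ ∈ Automorphism ] Automorphism.apply σ a ≈ᵛ b

------------------------------------------------------------------------
-- Imaginaries

module _ (L : Language) (T : Theory L) where
  open Syntax L

  -- One sort w / E for each E which T says is an equivalence relation.
  -- The membership proof is irrelevant: it does not multiply sorts.

  data EqSort : Set where
    home : Sort → EqSort
    quot : (w : List Sort) (E : Formula (⟨ w ⟩ ⊕ ⟨ w ⟩)) → .(T (equivᶠ w E)) → EqSort

  data EqFun : List EqSort → EqSort → Set where
    base : ∀ {w s} → Fun w s → EqFun (map home w) (home s)
    proj : ∀ w E .(e : T (equivᶠ w E)) → EqFun (map home w) (quot w E e)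

  data EqRel : List EqSort → Set where
    base : ∀ {w} → Rel w → EqRel (map home w)

  language^eq : Language
  language^eq = record { Sort = EqSort ; Fun = EqFun ; Rel = EqRel }

module _ {L : Language} {T : Theory L} (complete : Complete L T)
         (M : Structure L) (M⊨T : Semantics.Models M T) where
  open Semantics M

  private
    recomputed : ∀ σ → .(T σ) → empty ⊨ σ
    recomputed σ t with complete σ
    ... | inj₁ u = M⊨T σ u
    ... | inj₂ n = ⊥-elim-irr (Level.lower (M⊨T (~ σ) n (M⊨T σ t)))

  quotient : ∀ w E → .(T (equivᶠ w E)) → Setoid 1ℓ 1ℓ
  quotient w E e = record
    { Carrier       = Val ⟨ w ⟩
    ; _≈_           = λ a b → a & b ⊨ E
    ; isEquivalence = record
      { refl  = λ {a} → equiv-refl w E h {a}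
      ; sym   = λ {a} {b} → equiv-sym w E h {a} {b}
      ; trans = λ {a} {b} {c} → equiv-trans w E h {a} {b} {c}
      }
    }
    where
    h : empty ⊨ equivᶠ w E
    h = recomputed (equivᶠ w E) e

  eqDom : EqSort L T → Setoid 1ℓ 1ℓ
  eqDom (home s)     = Dom s
  eqDom (quot w E e) = quotient w E e

  private
    homes : ∀ {w} → (∀ s → s ∈ map home w → Setoid.Carrier (eqDom s)) → Val ⟨ w ⟩
    homes a s i = a (home s) (∈-map⁺ home i)

    eqFun : ∀ {w s} → EqFun L T w s →
            (∀ t → t ∈ w → Setoid.Carrier (eqDom t)) → Setoid.Carrier (eqDom s)
    eqFun (base f)     a = ⟦ f ⟧ᶠ (homes a)
    eqFun (proj w E e) a = homes a

    eqFun-cong : ∀ {w s} (f : EqFun L T w s)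
                 {a b : ∀ t → t ∈ w → Setoid.Carrier (eqDom t)} →
                 (∀ t (i : t ∈ w) → Setoid._≈_ (eqDom t) (a t i) (b t i)) →
                 Setoid._≈_ (eqDom s) (eqFun f a) (eqFun f b)
    eqFun-cong (base f)     k = ⟦ f ⟧ᶠ-cong (λ s i → k (home s) (∈-map⁺ home i))
    eqFun-cong (proj w E e) k =
      equiv-≈ᵛ w E (recomputed (equivᶠ w E) e) (λ s i → k (home s) (∈-map⁺ home i))

    eqRel : ∀ {w} → EqRel L T w → (∀ t → t ∈ w → Setoid.Carrier (eqDom t)) → Set₁
    eqRel (base r) a = ⟦ r ⟧ʳ (homes a)

    eqRel-cong : ∀ {w} (r : EqRel L T w)
                 {a b : ∀ t → t ∈ w → Setoid.Carrier (eqDom t)} →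
                 (∀ t (i : t ∈ w) → Setoid._≈_ (eqDom t) (a t i) (b t i)) →
                 eqRel r a → eqRel r b
    eqRel-cong (base r) k = ⟦ r ⟧ʳ-cong (λ s i → k (home s) (∈-map⁺ home i))

  structure^eq : Structure (language^eq L T)
  structure^eq = record
    { Dom       = eqDom
    ; ⟦_⟧ᶠ      = eqFun
    ; ⟦_⟧ᶠ-cong = eqFun-cong
    ; ⟦_⟧ʳ      = eqRel
    ; ⟦_⟧ʳ-cong = eqRel-cong
    }

------------------------------------------------------------------------
-- Þ-forking and þ-ranks

-- sup I i α is the supremum of a nonempty family; every limit ordinal
-- arises this way.  If the supremum is attained, "rank ≥ each α i" is
-- still "rank ≥ sup", because rank ≥ β implies rank ≥ α for α ≤ β.

data Ordinal : Set₂ where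
  zero : Ordinal
  suc  : Ordinal → Ordinal
  sup  : (I : Set₁) → I → (I → Ordinal) → Ordinal

module Thorn {L : Language} (N : Structure L) where
  open Types N public

  Finite Infinite : ∀ {w} → Pred (Tuple w) 1ℓ → Set₁
  Finite   P = ∃[ as ] ∀ a → P a → Any (a ≈ᵛ_) as
  Infinite P = ¬ Finite P

  Algebraic : ∀ {y A} → Partial ⟨ y ⟩ A → Val A → Set₁
  Algebraic p a = ∃[ φ ] p φ × Finite (λ b → b & a ⊨ φ)

  -- k-inconsistency of the family { δ(x , a) : P a }, indexed by tuples a.

  Inconsistent : ∀ {x y} → ℕ → Formula (⟨ x ⟩ ⊕ ⟨ y ⟩) → Pred (Tuple y) 1ℓ → Set₁
  Inconsistent {x} {y} k δ P =
    (as : Fin k → Tuple y) → (∀ i → P (as i)) →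
    (∀ i j → ¬ i ≡ j → ¬ as i ≈ᵛ as j) →
    ¬ (Σ[ b ∈ Tuple x ] ∀ i → b & as i ⊨ δ)

  module _ {x y : List Sort} (δ : Formula (⟨ x ⟩ ⊕ ⟨ y ⟩)) (d : Tuple y) where

    StronglyDivides : ∀ {A} → Val A → Set₁
    StronglyDivides a =
      ¬ Algebraic (tp d a) a × ∃[ k ] Inconsistent k δ (Realizes (tp d a) a)

    ThornDivides : ∀ {A} → Val A → Set₁
    ThornDivides a = Σ[ C ∈ Ctx ] Σ[ c ∈ Val C ] StronglyDivides (a & c)

  record Instance (x : List Sort) : Set₁ where
    constructor inst
    field
      {y} : List Sort
      δ   : Formula (⟨ x ⟩ ⊕ ⟨ y ⟩)
      d   : Tuple y

  ThornForks : ∀ {x P A} → Formula (⟨ x ⟩ ⊕ P) → Val P → Val A → Set₁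
  ThornForks {x} θ e a =
    Σ[ ds ∈ List (Instance x) ]
      All (λ (inst δ d) → ThornDivides δ d a) ds ×
      (∀ b → b & e ⊨ θ → Any (λ (inst δ d) → b & d ⊨ δ) ds)

  TypeThornForks : ∀ {x B A} → Partial ⟨ x ⟩ B → Val B → Val A → Set₁
  TypeThornForks {x} p b a =
    Σ[ P ∈ Ctx ] Σ[ θ ∈ Formula (⟨ x ⟩ ⊕ P) ] Σ[ e ∈ Val P ]
      (∀ c → Realizes p b c → c & e ⊨ θ) × ThornForks θ e a

  module _ {x y : List Sort} {z : Ctx}
           (Δ : List (Formula (⟨ x ⟩ ⊕ ⟨ y ⟩)))
           (Π : List (Formula (⟨ y ⟩ ⊕ z))) (k : ℕ) where

    -- RankAtLeast α φ e is th(φ(x , e) , Δ , Π , k) ≥ α.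

    RankAtLeast : ∀ {P} → Ordinal → Formula (⟨ x ⟩ ⊕ P) → Val P → Set₁
    RankAtLeast zero φ e = ∃[ b ] b & e ⊨ φ
    RankAtLeast {P} (suc α) φ e =
      Σ[ δ ∈ Formula (⟨ x ⟩ ⊕ ⟨ y ⟩) ] δ ∈ Δ ×
      Σ[ π ∈ Formula (⟨ y ⟩ ⊕ z) ] π ∈ Π ×
      Σ[ c ∈ Val z ]
        Infinite (λ a → a & c ⊨ π × RankAtLeast α (conj δ) (e & a)) ×
        Inconsistent k δ (λ a → a & c ⊨ π)
      where
      conj : Formula (⟨ x ⟩ ⊕ ⟨ y ⟩) → Formula (⟨ x ⟩ ⊕ (P ⊕ ⟨ y ⟩))
      conj δ = ren (λ _ → [ inj₁ , inj₂ ∘ inj₁ ]) φ ∧ ren (λ _ → [ inj₁ , inj₂ ∘ inj₂ ]) δ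
    RankAtLeast (sup I _ α) φ e = ∀ i → RankAtLeast (α i) φ e

  -- An inconsistent formula has no rank ≥ 0; it counts as having rank -∞,
  -- not as having an undefined rank.

  RanksDefined : Set₂
  RanksDefined =
    ∀ {x y z P} Δ Π k (φ : Formula (⟨ x ⟩ ⊕ P)) (e : Val P) →
    ∃[ α ] ¬ RankAtLeast {x} {y} {z} Δ Π k α φ e

  Subset : Ctx → Set₁
  Subset A = ∀ s → A s → Set

  restrict : (A : Ctx) → Subset A → Ctx
  restrict A S s = Σ (A s) (S s)

  _↾_ : ∀ {A} → Val A → (S : Subset A) → Val (restrict A S)
  (a ↾ S) s (v , _) = a s v

  -- The cardinal bound is the cardinality of K.

  ThornLocalCharacter : Set → Set₂
  ThornLocalCharacter K =
    ∀ {x A} (a : Val A) (p : Partial ⟨ x ⟩ A) → CompleteType p a →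
    Σ[ S ∈ Subset A ] (Σ Sort (restrict A S) ↣ K) × ¬ TypeThornForks p a (a ↾ S)

module _ {L : Language} {T : Theory L} (complete : Complete L T)
         (𝒞 : Structure L) (𝒞⊨T : Semantics.Models 𝒞 T) where

  open Thorn (structure^eq complete 𝒞 𝒞⊨T)

  Rosy : Set₂
  Rosy = RanksDefined

  LocalCharacter : Set₂
  LocalCharacter = ThornLocalCharacter (FormulasOf L)

{-# OPTIONS --safe #-}
module Submission where

-- Rosy implies local character: for each (Δ , Π , k) choose in p a formula φ of minimal
-- rank β, and let A₀ be the set of parameters of the chosen formulas.  If p implied a
-- disjunction of formulas δᵢ(x , dᵢ) þ-dividing over A₀, then, ranks of disjunctions being
-- maxima, φ ∧ δᵢ(x , dᵢ) would have rank ≥ β for some i, where (Δ , Π , k) is made up of the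
-- δᵢ and of formulas witnessing the þ-dividing.  The infinitely many conjugates of dᵢ over
-- A₀ and the witnessing parameters then give φ rank ≥ β + 1.
--
-- Local character implies rosy: if a rank is undefined, compactness yields δ, a point b and
-- a chain of tuples aᵢ of length |T|⁺ such that b ⊨ δ(x , aᵢ) and δ(x , aᵢ) þ-divides over
-- the earlier tuples.  A set of at most |T| of the aᵢ is bounded, say by i, so that δ(x , aᵢ)
-- witnesses that tp(b / all aⱼ) þ-forks over it.
--
-- Saturation passes to imaginaries because the truth of a formula about classes is
-- definable in terms of representatives.

open import Defs
open import Axiom.ExcludedMiddle using (ExcludedMiddle)
open import Function.Bundles using (_⇔_; _↣_; mk⇔; mk↣; Injection)
open import Function.Construct.Composition using (_↣-∘_)
import Level
open import Level using (lower)
import Data.Empty as Empty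
open import Data.Empty using (⊥-elim)
open import Data.Fin.Base using (Fin; zero; suc; inject≤)
import Data.Fin.Properties as Fin
open import Data.List.Base using (List; []; _∷_; _++_; length; lookup; map; filter; cartesianProduct)
open import Data.List.Membership.Propositional using (_∈_)
open import Data.List.Membership.Propositional.Properties
  using (∈-map⁺; ∈-filter⁺; ∈-filter⁻; ∈-++⁺ˡ; ∈-++⁺ʳ; ∈-cartesianProduct⁺)
open import Data.List.Relation.Unary.All as All using (All; []; _∷_)
open import Data.List.Relation.Unary.AllPairs using (AllPairs; []; _∷_)
import Data.List.Relation.Unary.AllPairs.Properties as AllPairs
open import Data.List.Relation.Unary.Any as Any using (Any; here; there)
open import Data.List.Relation.Unary.Any.Properties using (map⁺; ++⁺ˡ; ++⁺ʳ)
open import Data.Maybe.Base using (Maybe; just; nothing)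
open import Data.Maybe.Properties using (just-injective)
open import Data.Nat.Base using (ℕ; zero; suc; _≤_; _⊔_)
open import Data.Nat.Properties using (n<1+n; m≤m⊔n; m≤n⊔m)
open import Data.Product.Base using (Σ; ∃-syntax; Σ-syntax; _×_; _,_; proj₁; proj₂)
open import Data.Sum.Base using (_⊎_; inj₁; inj₂; [_,_]; swap)
open import Function.Base using (_∘_; id)
open import Relation.Binary.PropositionalEquality using (_≡_; _≢_; refl; sym; trans; cong; subst)
open import Relation.Nullary.Decidable.Core using (Dec; yes; no)
open import Relation.Nullary.Negation using (¬_)
open import Relation.Unary using (Pred)

-- The δᵢ of a þ-forking disjunction have parameter tuples of different sorts, while a rank admits a
-- single `y`; they must first be padded to a common tuple. Conjugates are compared through equality
-- of types: ranks are moved by back and forth, each chosen element joining the parameters.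
-- `Ordinal` has no order. A minimal rank is found by descending along an ordinal that bounds the
-- rank of `⊤ᶠ`, and ordinals are compared by the rank conditions that they impose. Cardinals do not
-- occur either. The place of |T|⁺ is taken by a partially ordered type of trees, whose finite
-- subsets must be sorted before a chain can be built along them; the bound |T| on A₀ becomes an
-- injection of finite trees of symbols into formulas. Compactness asks for a small type of
-- conditions. Membership in a type p is a large proposition, so the conditions are indexed by all
-- formulas φ and carry `p φ` as a hypothesis. Infinitude is not first-order and enters as "at least
-- m" for each m.

module Classical (em : ∀ {ℓ} → ExcludedMiddle ℓ) where

  dne : ∀ {ℓ} {P : Set ℓ} → ¬ ¬ P → P
  dne {P = P} h with em {P = P}
  ... | yes p = p
  ... | no ¬p = ⊥-elim (h ¬p)

  ¬∀⇒∃¬ : ∀ {a b} {A : Set a} {B : A → Set b} → ¬ (∀ x → B x) → ∃[ x ] ¬ B x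
  ¬∀⇒∃¬ h = dne λ k → h λ x → dne λ ¬b → k (x , ¬b)

  ¬→⇒×¬ : ∀ {a b} {A : Set a} {B : Set b} → ¬ (A → B) → A × ¬ B
  ¬→⇒×¬ h = ¬∀⇒∃¬ h

  -- Finite satisfiability of guarded conditions `Q x → P x`: it is enough to satisfy `P` on the
  -- sublist where the guard is true, which can be conjoined into one formula.
  select : ∀ {a q r} {A : Set a} (Q : A → Set q) (xs : List A) →
           ∃[ ys ] All Q ys × (∀ {P : A → Set r} → All P ys → All (λ x → Q x → P x) xs)
  select Q [] = [] , [] , λ _ → []
  select {r = r} Q (x ∷ xs) with select {r = r} Q xs | em {P = Q x}
  ... | ys , qs , f | yes q = x ∷ ys , q ∷ qs , λ { (p ∷ ps) → (λ _ → p) ∷ f ps }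
  ... | ys , qs , f | no ¬q = ys , qs , λ ps → (λ q → ⊥-elim (¬q q)) ∷ f ps

module _ {a b} {A : Set a} {F : A → Set b} where

  -- `F` is left general because both tuples of elements and renamings of finite contexts are
  -- concatenated.
  join : ∀ {v w : List A} → (∀ s → s ∈ v → F s) → (∀ s → s ∈ w → F s) → ∀ s → s ∈ v ++ w → F s
  join {[]}    f g s i         = g s i
  join {_ ∷ v} f g s (here e)  = f s (here e)
  join {_ ∷ v} f g s (there i) = join (λ t → f t ∘ there) g s i

  join-ˡ : ∀ {v w : List A} (f : ∀ s → s ∈ v → F s) (g : ∀ s → s ∈ w → F s) s i → join f g s (∈-++⁺ˡ i) ≡ f s i
  join-ˡ f g s (here e)  = refl
  join-ˡ f g s (there i) = join-ˡ (λ t → f t ∘ there) g s i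

  join-ʳ : ∀ {v w : List A} (f : ∀ s → s ∈ v → F s) (g : ∀ s → s ∈ w → F s) s i → join f g s (∈-++⁺ʳ v i) ≡ g s i
  join-ʳ {[]}    f g s i = refl
  join-ʳ {_ ∷ v} f g s i = join-ʳ (λ t → f t ∘ there) g s i

-- Valuations, derived formulas and counting of tuples

module Valuations {L : Language} (N : Structure L) where
  open Thorn N

  pull : ∀ {Γ Δ : Ctx} → Ren Γ Δ → Val Δ → Val Γ
  pull ρ b s v = b s (ρ s v)

  fst : ∀ {Γ Δ : Ctx} → Val (Γ ⊕ Δ) → Val Γ
  fst = pull λ _ → inj₁

  snd : ∀ {Γ Δ : Ctx} → Val (Γ ⊕ Δ) → Val Δ
  snd = pull λ _ → inj₂

  ≈-refl : ∀ {Γ : Ctx} {a : Val Γ} → a ≈ᵛ a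
  ≈-refl s v = Dom.refl s

  ≈-sym : ∀ {Γ : Ctx} {a b : Val Γ} → a ≈ᵛ b → b ≈ᵛ a
  ≈-sym e s v = Dom.sym s (e s v)

  ≈-trans : ∀ {Γ : Ctx} {a b c : Val Γ} → a ≈ᵛ b → b ≈ᵛ c → a ≈ᵛ c
  ≈-trans e f s v = Dom.trans s (e s v) (f s v)

  &-≈ : ∀ {Γ Δ : Ctx} {a a′ : Val Γ} {b b′ : Val Δ} → a ≈ᵛ a′ → b ≈ᵛ b′ → (a & b) ≈ᵛ (a′ & b′)
  &-≈ e f s (inj₁ v) = e s v
  &-≈ e f s (inj₂ v) = f s v

  ⊨-cong : ∀ {Γ : Ctx} {a b : Val Γ} → a ≈ᵛ b → ∀ φ → a ⊨ φ → b ⊨ φ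
  ⊨-cong e φ h = ⊨-ren⁻ (λ _ → id) ≈-refl φ (⊨-ren⁺ (λ _ → id) e φ h)

  ⊕-ren : ∀ {Γ Γ′ Δ Δ′ : Ctx} → Ren Γ Γ′ → Ren Δ Δ′ → Ren (Γ ⊕ Δ) (Γ′ ⊕ Δ′)
  ⊕-ren ρ σ s = [ inj₁ ∘ ρ s , inj₂ ∘ σ s ]

  alls-intro : ∀ {Γ : Ctx} {a : Val Γ} w (φ : Formula (Γ ⊕ ⟨ w ⟩)) → (∀ b → a & b ⊨ φ) → a ⊨ alls w φ
  alls-intro {a = a} [] φ h = ⊨-ren⁺ unpack[] (λ { s (inj₁ v) → Dom.refl s }) φ (h λ _ ())
  alls-intro {a = a} (s ∷ w) φ h x = alls-intro w _ λ b →
    ⊨-ren⁺ unpack∷ (λ { t (inj₁ v) → Dom.refl t ; t (inj₂ (here refl)) → Dom.refl t ; t (inj₂ (there i)) → Dom.refl t })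
      φ (h (cons b))
    where
    cons : Tuple w → Tuple (s ∷ w)
    cons b _ (here refl) = x
    cons b t (there i)   = b t i

  ⊤ᶠ : ∀ {Γ : Ctx} → Formula Γ
  ⊤ᶠ = ⊥ᶠ ⇒ ⊥ᶠ

  ⋀ : ∀ {Γ : Ctx} → List (Formula Γ) → Formula Γ
  ⋀ []       = ⊤ᶠ
  ⋀ (φ ∷ φs) = φ ∧ ⋀ φs

  ⋀-intro : ∀ {Γ : Ctx} {a : Val Γ} {φs} → All (a ⊨_) φs → a ⊨ ⋀ φs
  ⋀-intro []       = id
  ⋀-intro (h ∷ hs) = h , ⋀-intro hs

  ⋀-elim : ∀ {Γ : Ctx} {a : Val Γ} φs → a ⊨ ⋀ φs → All (a ⊨_) φs
  ⋀-elim []       _        = []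
  ⋀-elim (φ ∷ φs) (h , hs) = h ∷ ⋀-elim φs hs

  eqᶠ : ∀ {Γ : Ctx} w → Ren ⟨ w ⟩ Γ → Ren ⟨ w ⟩ Γ → Formula Γ
  eqᶠ []      ρ σ = ⊤ᶠ
  eqᶠ (s ∷ w) ρ σ =
    (var (ρ s (here refl)) ≐ var (σ s (here refl))) ∧ eqᶠ w (λ t → ρ t ∘ there) (λ t → σ t ∘ there)

  eqᶠ-sound : ∀ {Γ : Ctx} w (ρ σ : Ren ⟨ w ⟩ Γ) {b : Val Γ} → b ⊨ eqᶠ w ρ σ → pull ρ b ≈ᵛ pull σ b
  eqᶠ-sound (s ∷ w) ρ σ (h , hs) _ (here refl) = h
  eqᶠ-sound (s ∷ w) ρ σ (h , hs) t (there i)   = eqᶠ-sound w _ _ hs t i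

  eqᶠ-complete : ∀ {Γ : Ctx} w (ρ σ : Ren ⟨ w ⟩ Γ) {b : Val Γ} → pull ρ b ≈ᵛ pull σ b → b ⊨ eqᶠ w ρ σ
  eqᶠ-complete []      ρ σ e = id
  eqᶠ-complete (s ∷ w) ρ σ e = e s (here refl) , eqᶠ-complete w _ _ (λ t i → e t (there i))

  -- The first-order approximations of `Infinite`: each can be expressed by a formula when `P` can.
  -- The recursion for this peels off one element at a time, by `uncons` and `cons`.
  AtLeast : ∀ {y} → ℕ → Pred (Tuple y) 1ℓ → Set₁
  AtLeast {y} k P = Σ[ as ∈ (Fin k → Tuple y) ] (∀ i → P (as i)) × (∀ i j → ¬ i ≡ j → ¬ as i ≈ᵛ as j)

  uncons : ∀ {y k} {P : Pred (Tuple y) 1ℓ} → AtLeast (suc k) P → ∃[ a ] P a × AtLeast k (λ b → P b × ¬ b ≈ᵛ a)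
  uncons (as , ps , ds) = as zero , ps zero , as ∘ suc ,
    (λ i → ps (suc i) , ds (suc i) zero λ ()) , λ i j i≢j → ds (suc i) (suc j) (i≢j ∘ Fin.suc-injective)

  cons : ∀ {y k} {P : Pred (Tuple y) 1ℓ} a → P a → AtLeast k (λ b → P b × ¬ b ≈ᵛ a) → AtLeast (suc k) P
  cons {y} {k} {P} a p (as , ps , ds) = as′ , ps′ , ds′
    where
    as′ : Fin (suc k) → Tuple y
    as′ zero    = a
    as′ (suc i) = as i
    ps′ : ∀ i → P (as′ i)
    ps′ zero    = p
    ps′ (suc i) = proj₁ (ps i)
    ds′ : ∀ i j → ¬ i ≡ j → ¬ as′ i ≈ᵛ as′ j
    ds′ zero    zero    n = λ _ → n refl
    ds′ zero    (suc j) n = proj₂ (ps j) ∘ ≈-sym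
    ds′ (suc i) zero    n = proj₂ (ps i)
    ds′ (suc i) (suc j) n = ds i j (n ∘ cong suc)

  AtLeast-mono : ∀ {y k} {P Q : Pred (Tuple y) 1ℓ} → (∀ a → P a → Q a) → AtLeast k P → AtLeast k Q
  AtLeast-mono f (as , ps , ds) = as , (λ i → f _ (ps i)) , ds

  ¬Finite : ∀ {y} {P : Pred (Tuple y) 1ℓ} → (∀ k → AtLeast k P) → Infinite P
  ¬Finite h (cs , cover) with h (suc (length cs))
  ... | as , ps , ds with Fin.pigeonhole (n<1+n _) (λ i → Any.index (cover _ (ps i)))
  ...   | i , j , i<j , e = ds i j (λ { refl → Fin.<-irrefl refl i<j })
          (≈-trans (near i) (subst (λ n → lookup cs n ≈ᵛ as j) (sym e) (≈-sym (near j))))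
    where
    near : ∀ i → as i ≈ᵛ lookup cs (Any.index (cover _ (ps i)))
    near i = go (cover _ (ps i))
      where
      go : ∀ {xs} {a} (q : Any (a ≈ᵛ_) xs) → a ≈ᵛ lookup xs (Any.index q)
      go (here e)  = e
      go (there q) = go q

  Inconsistent-mono : ∀ {x y k} {δ : Formula (⟨ x ⟩ ⊕ ⟨ y ⟩)} {P Q : Pred (Tuple y) 1ℓ} →
                      (∀ a → Q a → P a) → Inconsistent k δ P → Inconsistent k δ Q
  Inconsistent-mono f h as qs = h as (λ i → f _ (qs i))

  Inconsistent-≤ : ∀ {x y k l} {δ : Formula (⟨ x ⟩ ⊕ ⟨ y ⟩)} {P : Pred (Tuple y) 1ℓ} →
                   k ≤ l → Inconsistent k δ P → Inconsistent l δ P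
  Inconsistent-≤ k≤l h as ps ds (b , bs) =
    h (λ i → as (inject≤ i k≤l)) (λ i → ps _) (λ i j n → ds _ _ (n ∘ Fin.inject≤-injective k≤l k≤l i j)) (b , λ i → bs _)

  -- Seen from a single point b, k-inconsistency is a bound on a number of tuples, and so as
  -- definable as `AtLeast`.
  Inconsistent⇒¬AtLeast : ∀ {x y k} {δ : Formula (⟨ x ⟩ ⊕ ⟨ y ⟩)} {P : Pred (Tuple y) 1ℓ} → Inconsistent k δ P →
                          ∀ b → ¬ AtLeast k (λ a → P a × b & a ⊨ δ)
  Inconsistent⇒¬AtLeast h b (as , ps , ds) = h as (λ i → proj₁ (ps i)) ds (b , λ i → proj₂ (ps i))

  ¬AtLeast⇒Inconsistent : ∀ {x y k} {δ : Formula (⟨ x ⟩ ⊕ ⟨ y ⟩)} {P : Pred (Tuple y) 1ℓ} →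
                          (∀ b → ¬ AtLeast k (λ a → P a × b & a ⊨ δ)) → Inconsistent k δ P
  ¬AtLeast⇒Inconsistent h as ps ds (b , bs) = h b (as , (λ i → ps i , bs i) , ds)

  Finite-mono : ∀ {y} {P Q : Pred (Tuple y) 1ℓ} → (∀ a → Q a → P a) → Finite P → Finite Q
  Finite-mono f (as , c) = as , λ a q → c a (f a q)

module Infinity (em : ∀ {ℓ} → ExcludedMiddle ℓ) {L : Language} (N : Structure L) where
  open Thorn N
  open Classical em
  open Valuations N

  Finite-remove : ∀ {y} {P : Pred (Tuple y) 1ℓ} c → Finite (λ a → P a × ¬ a ≈ᵛ c) → Finite P
  Finite-remove {P = P} c (as , cover) = c ∷ as , λ a p → go a p em
    where
    go : ∀ a → P a → Dec (a ≈ᵛ c) → Any (a ≈ᵛ_) (c ∷ as)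
    go a p (yes e) = here e
    go a p (no n)  = there (cover a (p , n))

  Finite-⊎ : ∀ {y} {P Q R : Pred (Tuple y) 1ℓ} → (∀ a → R a → P a ⊎ Q a) → Finite P → Finite Q → Finite R
  Finite-⊎ f (as , c) (bs , d) = as ++ bs , λ a r → go a (f a r)
    where
    go : ∀ a → _ → Any (a ≈ᵛ_) (as ++ bs)
    go a (inj₁ p) = ++⁺ˡ (c a p)
    go a (inj₂ q) = ++⁺ʳ as (d a q)

  Infinite⇒∃ : ∀ {y} {P : Pred (Tuple y) 1ℓ} → Infinite P → ∃[ a ] P a
  Infinite⇒∃ h = dne λ n → h ([] , λ a p → ⊥-elim (n (a , p)))

  Infinite⇒AtLeast : ∀ {y} {P : Pred (Tuple y) 1ℓ} → Infinite P → ∀ k → AtLeast k P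
  Infinite⇒AtLeast h zero = (λ ()) , (λ ()) , λ ()
  Infinite⇒AtLeast h (suc k) with Infinite⇒∃ h
  ... | a , p = cons a p (Infinite⇒AtLeast (h ∘ Finite-remove a) k)

  Infinite-∖ : ∀ {y} {P Q : Pred (Tuple y) 1ℓ} → Infinite P → Finite Q → ∃[ a ] P a × ¬ Q a
  Infinite-∖ {P = P} {Q} h f = dne λ n → h (Finite-mono (λ a p → dne λ ¬q → n (a , p , ¬q)) f)

-- Definable predicates and compactness

module Definability (em : ∀ {ℓ} → ExcludedMiddle ℓ) {L : Language} (N : Structure L) where
  open Thorn N
  open Classical em
  open Valuations N

  -- Conditions are stated as Agda predicates and shown definable by closure properties, so that
  -- their formulas, with the bookkeeping of variables, are never written out. The parameters may
  -- form any small set.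
  record Definable {Γ : Ctx} (D : Val Γ → Set₁) : Set₁ where
    constructor definable
    field
      {A}      : Ctx
      a        : Val A
      φ        : Formula (Γ ⊕ A)
      sound    : ∀ b → b & a ⊨ φ → D b
      complete : ∀ b → D b → b & a ⊨ φ

  def-⇔ : ∀ {Γ : Ctx} {D E : Val Γ → Set₁} → (∀ b → D b → E b) → (∀ b → E b → D b) → Definable D → Definable E
  def-⇔ f g (definable a φ s c) = definable a φ (λ b → f b ∘ s b) (λ b → c b ∘ g b)

  def-pull : ∀ {Γ Δ : Ctx} {D : Val Γ → Set₁} (ρ : Ren Γ Δ) → Definable D → Definable (λ b → D (pull ρ b))
  def-pull ρ (definable a φ s c) = definable a (ren (⊕-ren ρ λ _ → id) φ)
    (λ b h → s _ (⊨-ren⁻ _ (e b) φ h)) (λ b h → ⊨-ren⁺ _ (e b) φ (c _ h))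
    where
    e : ∀ b → (pull ρ b & a) ≈[ ⊕-ren ρ (λ _ → id) ] (b & a)
    e b s (inj₁ v) = Dom.refl s
    e b s (inj₂ v) = Dom.refl s

  def-param : ∀ {Γ Δ : Ctx} {D : Val (Γ ⊕ Δ) → Set₁} (d : Val Δ) → Definable D → Definable (λ b → D (b & d))
  def-param {Γ} {Δ} d (definable {A} a φ s c) = definable (d & a) (ren ρ φ)
    (λ b h → s _ (⊨-ren⁻ ρ (e b) φ h)) (λ b h → ⊨-ren⁺ ρ (e b) φ (c _ h))
    where
    ρ : Ren (Γ ⊕ Δ ⊕ A) (Γ ⊕ (Δ ⊕ A))
    ρ s = [ [ inj₁ , inj₂ ∘ inj₁ ] , inj₂ ∘ inj₂ ]
    e : ∀ b → (b & d & a) ≈[ ρ ] (b & (d & a))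
    e b s (inj₁ (inj₁ v)) = Dom.refl s
    e b s (inj₁ (inj₂ v)) = Dom.refl s
    e b s (inj₂ v)        = Dom.refl s

  def-⊨ : ∀ {Γ Δ Θ : Ctx} (φ : Formula (Γ ⊕ Δ)) (ρ : Ren Γ Θ) (σ : Ren Δ Θ) → Definable (λ b → pull ρ b & pull σ b ⊨ φ)
  def-⊨ φ ρ σ = definable empty (ren (λ s → inj₁ ∘ [ ρ s , σ s ]) φ)
    (λ b → ⊨-ren⁻ _ (e b) φ) (λ b → ⊨-ren⁺ _ (e b) φ)
    where
    e : ∀ b → (pull ρ b & pull σ b) ≈[ (λ s → inj₁ ∘ [ ρ s , σ s ]) ] (b & empty)
    e b s (inj₁ v) = Dom.refl s
    e b s (inj₂ v) = Dom.refl s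

  def-formula : ∀ {Γ Θ : Ctx} {E : Val Θ → Val Γ} (φ : Formula Γ) (ρ : Ren Γ Θ) →
                (∀ b → E b ≈[ ρ ] b) → Definable (λ b → E b ⊨ φ)
  def-formula φ ρ e = definable empty (ren (λ s → inj₁ ∘ ρ s) φ) (λ b → ⊨-ren⁻ _ (e b) φ) (λ b → ⊨-ren⁺ _ (e b) φ)

  def-⊨-param : ∀ {Γ A : Ctx} (φ : Formula (Γ ⊕ A)) (a : Val A) → Definable (λ b → b & a ⊨ φ)
  def-⊨-param φ a = definable a φ (λ _ → id) (λ _ → id)

  def-≈ : ∀ {Γ : Ctx} {w} (ρ σ : Ren ⟨ w ⟩ Γ) → Definable (λ b → pull ρ b ≈ᵛ pull σ b)
  def-≈ {w = w} ρ σ = definable empty (eqᶠ w (λ s → inj₁ ∘ ρ s) (λ s → inj₁ ∘ σ s))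
    (λ b → eqᶠ-sound w _ _) (λ b → eqᶠ-complete w _ _)

  def-true : ∀ {Γ : Ctx} {D : Val Γ → Set₁} → (∀ b → D b) → Definable D
  def-true h = definable empty ⊤ᶠ (λ b _ → h b) (λ _ _ → id)

  def-¬ : ∀ {Γ : Ctx} {D : Val Γ → Set₁} → Definable D → Definable (λ b → ¬ D b)
  def-¬ (definable a φ s c) = definable a (~ φ) (λ b h d → lower (h (c b d))) (λ b n h → Level.lift (n (s b h)))

  def-× : ∀ {Γ : Ctx} {D E : Val Γ → Set₁} → Definable D → Definable E → Definable (λ b → D b × E b)
  def-× {Γ} (definable {A} a φ s c) (definable {B} a′ φ′ s′ c′) = definable (a & a′) (ren ρ φ ∧ ren σ φ′)
    (λ b (h , h′) → s b (⊨-ren⁻ ρ (e b) φ h) , s′ b (⊨-ren⁻ σ (e′ b) φ′ h′))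
    (λ b (d , d′) → ⊨-ren⁺ ρ (e b) φ (c b d) , ⊨-ren⁺ σ (e′ b) φ′ (c′ b d′))
    where
    ρ : Ren (Γ ⊕ A) (Γ ⊕ (A ⊕ B))
    ρ s = [ inj₁ , inj₂ ∘ inj₁ ]
    σ : Ren (Γ ⊕ B) (Γ ⊕ (A ⊕ B))
    σ s = [ inj₁ , inj₂ ∘ inj₂ ]
    e : ∀ b → (b & a) ≈[ ρ ] (b & (a & a′))
    e b s (inj₁ v) = Dom.refl s
    e b s (inj₂ v) = Dom.refl s
    e′ : ∀ b → (b & a′) ≈[ σ ] (b & (a & a′))
    e′ b s (inj₁ v) = Dom.refl s
    e′ b s (inj₂ v) = Dom.refl s

  def-→ : ∀ {Γ : Ctx} {D E : Val Γ → Set₁} → Definable D → Definable E → Definable (λ b → D b → E b)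
  def-→ d e = def-⇔ (λ b h x → dne λ n → h (x , n)) (λ b h (x , n) → n (h x)) (def-¬ (def-× d (def-¬ e)))

  def-⊎ : ∀ {Γ : Ctx} {D E : Val Γ → Set₁} → Definable D → Definable E → Definable (λ b → D b ⊎ E b)
  def-⊎ d e = def-⇔ (λ b h → dne λ n → h (n ∘ inj₁ , n ∘ inj₂)) (λ b h (m , n) → [ m , n ] h) (def-¬ (def-× (def-¬ d) (def-¬ e)))

  def-Any : ∀ {I : Set₁} {Γ : Ctx} {D : I → Val Γ → Set₁} → (∀ i → Definable (D i)) →
            ∀ is → Definable (λ b → Any (λ i → D i b) is)
  def-Any d []       = definable empty ⊥ᶠ (λ _ h → ⊥-elim (lower h)) (λ _ ())
  def-Any d (i ∷ is) = def-⇔ (λ b → λ { (inj₁ h) → here h ; (inj₂ h) → there h })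
                             (λ b → λ { (here h) → inj₁ h ; (there h) → inj₂ h }) (def-⊎ (d i) (def-Any d is))

  -- By excluded middle a fixed proposition is defined by truth or by falsity; this admits guards
  -- such as `p φ` in definable conditions.
  def-const : ∀ {Γ : Ctx} (Q : Set₁) → Definable {Γ} (λ _ → Q)
  def-const Q with em {P = Q}
  ... | yes q = def-true λ _ → q
  ... | no ¬q = definable empty ⊥ᶠ (λ _ h → ⊥-elim (lower h)) (λ _ q → ⊥-elim (¬q q))

  def-guard : ∀ {Q : Set} {Γ : Ctx} {D : Val Γ → Set₁} → Definable D → Definable (λ b → Q → D b)
  def-guard {Q} d with em {P = Q}
  ... | yes q = def-⇔ (λ b x _ → x) (λ b x → x q) d
  ... | no ¬q = def-true λ _ q → ⊥-elim (¬q q)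

  def-Fin : ∀ {k} {Γ : Ctx} {D : Fin k → Val Γ → Set₁} → (∀ i → Definable (D i)) → Definable (λ b → ∀ i → D i b)
  def-Fin {zero}  d = def-true λ _ ()
  def-Fin {suc k} d = def-⇔ (λ b (x , xs) → λ { zero → x ; (suc i) → xs i }) (λ b xs → xs zero , xs ∘ suc)
                        (def-× (d zero) (def-Fin (d ∘ suc)))

  def-∀ : ∀ {Γ : Ctx} {w} {D : Val (Γ ⊕ ⟨ w ⟩) → Set₁} → Definable D → Definable (λ b → ∀ t → D (b & t))
  def-∀ {Γ} {w} (definable {A} a φ s c) = definable a (alls w (ren ρ φ))
    (λ b h t → s _ (⊨-ren⁻ ρ (e b t) φ (alls-elim w _ h t)))
    (λ b h → alls-intro w _ λ t → ⊨-ren⁺ ρ (e b t) φ (c _ (h t)))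
    where
    ρ : Ren (Γ ⊕ ⟨ w ⟩ ⊕ A) (Γ ⊕ A ⊕ ⟨ w ⟩)
    ρ s = [ [ inj₁ ∘ inj₁ , inj₂ ] , inj₁ ∘ inj₂ ]
    e : ∀ b t → (b & t & a) ≈[ ρ ] (b & a & t)
    e b t s (inj₁ (inj₁ v)) = Dom.refl s
    e b t s (inj₁ (inj₂ v)) = Dom.refl s
    e b t s (inj₂ v)        = Dom.refl s

  def-∃ : ∀ {Γ : Ctx} {w} {D : Val (Γ ⊕ ⟨ w ⟩) → Set₁} → Definable D → Definable (λ b → ∃[ t ] D (b & t))
  def-∃ d = def-⇔ (λ b h → dne λ n → h λ t x → n (t , x)) (λ b (t , x) h → h t x) (def-¬ (def-∀ (def-¬ d)))

  def-AtLeast : ∀ {Γ : Ctx} {y} k {P : Val Γ → Tuple y → Set₁} → Definable {Γ ⊕ ⟨ y ⟩} (λ v → P (fst v) (snd v)) →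
                Definable (λ b → AtLeast k (P b))
  def-AtLeast zero d = def-true λ _ → (λ ()) , (λ ()) , λ ()
  def-AtLeast {Γ} {y} (suc k) {P} d =
    def-⇔ (λ b (a , p , h) → cons a p h) (λ b → uncons)
      (def-∃ {D = λ v → P (fst v) (snd v) × AtLeast k (λ t → P (fst v) t × ¬ t ≈ᵛ snd v)}
        (def-× d (def-AtLeast k {P = λ v t → P (fst v) t × ¬ t ≈ᵛ snd v}
          (def-× (def-pull (λ s → [ inj₁ ∘ inj₁ , inj₂ ]) d) (def-¬ (def-≈ (λ s → inj₂) (λ s → inj₁ ∘ inj₂)))))))

Saturated : {L : Language} → Structure L → Set₂
Saturated {L} N = ∀ {Γ A : Ctx} (a : Val A) (p : Partial Γ A) → FinitelySatisfiable p a → ∃[ b ] Realizes p a b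
  where open Types N

module Compactness (em : ∀ {ℓ} → ExcludedMiddle ℓ) {L : Language} (N : Structure L) (saturated : Saturated N) where
  open Thorn N
  open Classical em
  open Valuations N
  open Infinity em N
  open Definability em N

  -- Each condition brings its own parameters. Their disjoint union `Λ` is still small because `I`
  -- is, so saturation applies to all conditions together.
  compactness : ∀ {Γ : Ctx} {I : Set} {D : I → Val Γ → Set₁} → (∀ i → Definable (D i)) →
                (∀ is → ∃[ b ] All (λ i → D i b) is) → ∃[ b ] ∀ i → D i b
  compactness {Γ} {I} {D} d fs =
    let b , h = saturated a p sat in b , λ i → sound (d i) b (⊨-ren⁻ (ρ i) (e i b) (φ (d i)) (h _ (Level.lift i , refl)))
    where
    open Definable using (A; φ; sound; complete)
    Λ : Ctx
    Λ s = Σ[ i ∈ I ] A (d i) s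
    a : Val Λ
    a s (i , v) = Definable.a (d i) s v
    ρ : ∀ i → Ren (Γ ⊕ A (d i)) (Γ ⊕ Λ)
    ρ i s = [ inj₁ , (λ v → inj₂ (i , v)) ]
    e : ∀ i b → (b & Definable.a (d i)) ≈[ ρ i ] (b & a)
    e i b s (inj₁ v) = Dom.refl s
    e i b s (inj₂ v) = Dom.refl s
    p : Partial Γ Λ
    p ψ = Σ[ i ∈ Level.Lift 1ℓ I ] ψ ≡ ren (ρ (lower i)) (φ (d (lower i)))
    sat : FinitelySatisfiable p a
    sat ψs ps with fs (All.reduce (λ {ψ} (i , _) → lower i) ps)
    ... | b , hs = b , go ps hs
      where
      go : ∀ {ψs} (ps : All p ψs) → All (λ i → D i b) (All.reduce (λ {ψ} (i , _) → lower i) ps) → All (λ ψ → b & a ⊨ ψ) ψs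
      go []                []       = []
      go ((Level.lift i , refl) ∷ ps) (h ∷ hs) = ⊨-ren⁺ (ρ i) (e i b) (φ (d i)) (complete (d i) b h) ∷ go ps hs

-- Finite supports of formulas

module Support {L : Language} (N : Structure L) where
  open Thorn N
  open Valuations N

  ≡⇒≈ : ∀ {s} {a b : Dom.Carrier s} → a ≡ b → Dom._≈_ s a b
  ≡⇒≈ {s} refl = Dom.refl s

  record TermSupport {Γ : Ctx} {s} (t : Term Γ s) : Set₁ where
    constructor tsupp
    field
      {w}  : List Sort
      ρ    : Ren ⟨ w ⟩ Γ
      t₀   : Term ⟨ w ⟩ s
      same : ∀ a → Dom._≈_ s (eval a t) (eval (pull ρ a) t₀)

  record TermsSupport {Γ : Ctx} {v} (ts : All (Term Γ) v) : Set₁ where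
    constructor tssupp
    field
      {w}  : List Sort
      ρ    : Ren ⟨ w ⟩ Γ
      ts₀  : All (Term ⟨ w ⟩) v
      same : ∀ a → evals a ts ≈ᵛ evals (pull ρ a) ts₀

  module _ {Γ : Ctx} {v w : List Sort} (ρ : Ren ⟨ v ⟩ Γ) (σ : Ren ⟨ w ⟩ Γ) where

    joinˡ : (a : Val Γ) → pull ρ a ≈[ (λ _ → ∈-++⁺ˡ) ] pull (join ρ σ) a
    joinˡ a s i = ≡⇒≈ (cong (a s) (sym (join-ˡ ρ σ s i)))

    joinʳ : (a : Val Γ) → pull σ a ≈[ (λ _ → ∈-++⁺ʳ v) ] pull (join ρ σ) a
    joinʳ a s i = ≡⇒≈ (cong (a s) (sym (join-ʳ ρ σ s i)))

  mutual
    term-support : ∀ {Γ : Ctx} {s} (t : Term Γ s) → TermSupport t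
    term-support {Γ} {s} (var v) = tsupp ρ (var (here refl)) λ a → Dom.refl s
      where
      ρ : Ren ⟨ s ∷ [] ⟩ Γ
      ρ _ (here refl) = v
    term-support (app f ts) with terms-support ts
    ... | tssupp ρ ts₀ e = tsupp ρ (app f ts₀) λ a → ⟦ f ⟧ᶠ-cong (e a)

    terms-support : ∀ {Γ : Ctx} {v} (ts : All (Term Γ) v) → TermsSupport ts
    terms-support [] = tssupp {w = []} (λ _ ()) [] λ a _ ()
    terms-support (t ∷ ts) with term-support t | terms-support ts
    ... | tsupp ρ t₀ e | tssupp σ ts₀ f =
      tssupp (join ρ σ) (renᵗ (λ _ → ∈-++⁺ˡ) t₀ ∷ renᵗˢ (λ _ → ∈-++⁺ʳ _) ts₀) λ a →
        λ { s (here refl) → Dom.trans s (e a) (eval-ren _ (joinˡ ρ σ a) t₀)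
          ; s (there i) → Dom.trans s (f a s i) (evals-ren _ (joinʳ ρ σ a) ts₀ s i) }

  record Split {Γ Δ : Ctx} {w} (ρ : Ren ⟨ w ⟩ (Γ ⊕ Δ)) : Set where
    constructor split
    field
      {v}  : List Sort
      σ    : Ren ⟨ v ⟩ Δ
      τ    : Ren ⟨ w ⟩ (Γ ⊕ ⟨ v ⟩)
      same : ∀ s i → ⊕-ren {Γ} {Γ} {⟨ v ⟩} {Δ} (λ _ → id) σ s (τ s i) ≡ ρ s i

  split-ren : ∀ {Γ Δ : Ctx} {w} (ρ : Ren ⟨ w ⟩ (Γ ⊕ Δ)) → Split ρ
  split-ren {w = []} ρ = split {v = []} (λ _ ()) (λ _ ()) λ _ ()
  split-ren {Γ} {Δ} {w = t ∷ w} ρ with split-ren (λ s → ρ s ∘ there) | ρ t (here refl) in eq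
  ... | split σ τ e | inj₁ x =
    split σ (λ { _ (here refl) → inj₁ x ; s (there i) → τ s i }) λ { _ (here refl) → sym eq ; s (there i) → e s i }
  ... | split {v} σ τ e | inj₂ x = split σ′ τ′ e′
    where
    σ′ : Ren ⟨ t ∷ v ⟩ Δ
    σ′ _ (here refl) = x
    σ′ s (there i)   = σ s i
    τ′ : Ren ⟨ t ∷ w ⟩ (Γ ⊕ ⟨ t ∷ v ⟩)
    τ′ _ (here refl) = inj₂ (here refl)
    τ′ s (there i)   = [ inj₁ , inj₂ ∘ there ] (τ s i)
    e′ : ∀ s i → ⊕-ren {Γ} {Γ} {⟨ t ∷ v ⟩} {Δ} (λ _ → id) σ′ s (τ′ s i) ≡ ρ s i
    e′ _ (here refl) = sym eq
    e′ s (there i) with τ s i | e s i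
    ... | inj₁ _ | q = q
    ... | inj₂ _ | q = q

  Equivalent : ∀ {Γ Δ : Ctx} → Ren Δ Γ → Formula Γ → Formula Δ → Set₁
  Equivalent ρ φ φ₀ = ∀ a → (a ⊨ φ → pull ρ a ⊨ φ₀) × (pull ρ a ⊨ φ₀ → a ⊨ φ)

  record FormulaSupport {Γ : Ctx} (φ : Formula Γ) : Set₁ where
    constructor fsupp
    field
      {w}  : List Sort
      ρ    : Ren ⟨ w ⟩ Γ
      φ₀   : Formula ⟨ w ⟩
      same : Equivalent ρ φ φ₀

  formula-support : ∀ {Γ : Ctx} (φ : Formula Γ) → FormulaSupport φ
  formula-support ⊥ᶠ = fsupp {w = []} (λ _ ()) ⊥ᶠ λ a → id , id
  formula-support (_≐_ {s} t u) with term-support t | term-support u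
  ... | tsupp ρ t₀ e | tsupp σ u₀ f = fsupp (join ρ σ) (renᵗ (λ _ → ∈-++⁺ˡ) t₀ ≐ renᵗ (λ _ → ∈-++⁺ʳ _) u₀) λ a →
    let e′ = Dom.trans s (e a) (eval-ren _ (joinˡ ρ σ a) t₀)
        f′ = Dom.trans s (f a) (eval-ren _ (joinʳ ρ σ a) u₀)
    in (λ h → Dom.trans s (Dom.sym s e′) (Dom.trans s h f′)) , (λ h → Dom.trans s e′ (Dom.trans s h (Dom.sym s f′)))
  formula-support (rel r ts) with terms-support ts
  ... | tssupp ρ ts₀ e = fsupp ρ (rel r ts₀) λ a → ⟦ r ⟧ʳ-cong (e a) , ⟦ r ⟧ʳ-cong (≈-sym (e a))
  formula-support (φ ∧ ψ) with formula-support φ | formula-support ψ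
  ... | fsupp ρ φ₀ e | fsupp σ ψ₀ f = fsupp (join ρ σ) (ren (λ _ → ∈-++⁺ˡ) φ₀ ∧ ren (λ _ → ∈-++⁺ʳ _) ψ₀) λ a →
    (λ (h , k) → ⊨-ren⁺ _ (joinˡ ρ σ a) φ₀ (proj₁ (e a) h) , ⊨-ren⁺ _ (joinʳ ρ σ a) ψ₀ (proj₁ (f a) k)) ,
    (λ (h , k) → proj₂ (e a) (⊨-ren⁻ _ (joinˡ ρ σ a) φ₀ h) , proj₂ (f a) (⊨-ren⁻ _ (joinʳ ρ σ a) ψ₀ k))
  formula-support (φ ⇒ ψ) with formula-support φ | formula-support ψ
  ... | fsupp ρ φ₀ e | fsupp σ ψ₀ f = fsupp (join ρ σ) (ren (λ _ → ∈-++⁺ˡ) φ₀ ⇒ ren (λ _ → ∈-++⁺ʳ _) ψ₀) λ a →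
    (λ h k → ⊨-ren⁺ _ (joinʳ ρ σ a) ψ₀ (proj₁ (f a) (h (proj₂ (e a) (⊨-ren⁻ _ (joinˡ ρ σ a) φ₀ k))))) ,
    (λ h k → proj₂ (f a) (⊨-ren⁻ _ (joinʳ ρ σ a) ψ₀ (h (⊨-ren⁺ _ (joinˡ ρ σ a) φ₀ (proj₁ (e a) k)))))
  formula-support {Γ} (all s φ) with formula-support φ
  -- The bound variable is moved to the left, where `split-ren` leaves it alone; only the free
  -- variables are collected into a tuple.
  ... | fsupp {w} ρ φ₀ e with split-ren {_≡ s} {Γ} (λ t → [ inj₂ , inj₁ ] ∘ ρ t)
  ...   | split {v} σ τ f = fsupp σ (all s (ren swapped φ₀)) λ a →
            (λ h x → ⊨-ren⁺ swapped (same a x) φ₀ (proj₁ (e _) (h x))) ,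
            (λ h x → proj₂ (e _) (⊨-ren⁻ swapped (same a x) φ₀ (h x)))
    where
    swapped : Ren ⟨ w ⟩ (⟨ v ⟩ ▹ s)
    swapped t i = [ inj₂ , inj₁ ] (τ t i)
    same : ∀ a x → pull ρ (a & single x) ≈[ swapped ] (pull σ a & single x)
    same a x t i with τ t i | ρ t i | f t i
    ... | inj₁ _ | inj₂ _ | refl = Dom.refl t
    ... | inj₂ _ | inj₁ _ | refl = Dom.refl t

  -- This makes a single formula depend on finitely many parameters, both when A₀ is counted and
  -- when the formulas of `Π` need a finite tuple `z`.
  record ParameterSupport {Γ Δ : Ctx} (φ : Formula (Γ ⊕ Δ)) : Set₁ where
    constructor psupp
    field
      {w}      : List Sort
      ρ        : Ren ⟨ w ⟩ Δ
      φ₀       : Formula (Γ ⊕ ⟨ w ⟩)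
      sound    : ∀ b d → b & pull ρ d ⊨ φ₀ → b & d ⊨ φ
      complete : ∀ b d → b & d ⊨ φ → b & pull ρ d ⊨ φ₀

  parameter-support : ∀ {Γ Δ : Ctx} (φ : Formula (Γ ⊕ Δ)) → ParameterSupport φ
  parameter-support φ with formula-support φ
  ... | fsupp ρ φ₀ e with split-ren ρ
  ...   | split σ τ f = psupp σ (ren τ φ₀) (λ b d h → proj₂ (e _) (⊨-ren⁻ τ (same b d) φ₀ h))
                                           (λ b d h → ⊨-ren⁺ τ (same b d) φ₀ (proj₁ (e _) h))
    where
    same : ∀ b d → pull ρ (b & d) ≈[ τ ] (b & pull σ d)
    same b d s i with τ s i | ρ s i | f s i
    ... | inj₁ _ | inj₁ _ | refl = Dom.refl s
    ... | inj₂ _ | inj₂ _ | refl = Dom.refl s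

-- Equality of types

module TypeLemmas (em : ∀ {ℓ} → ExcludedMiddle ℓ) {L : Language} (N : Structure L) (saturated : Saturated N) where
  open Thorn N
  open Classical em
  open Valuations N
  open Infinity em N
  open Definability em N
  open Compactness em N saturated

  infix 4 _≡ᵗ_
  _≡ᵗ_ : ∀ {Γ : Ctx} → Val Γ → Val Γ → Set₁
  a ≡ᵗ b = ∀ φ → a ⊨ φ → b ⊨ φ

  ≡ᵗ-sym : ∀ {Γ : Ctx} {a b : Val Γ} → a ≡ᵗ b → b ≡ᵗ a
  ≡ᵗ-sym e φ h = dne λ n → lower (e (~ φ) (λ k → ⊥-elim (n k)) h)

  ≡ᵗ-pull : ∀ {Γ Δ : Ctx} (ρ : Ren Γ Δ) {a b : Val Δ} → a ≡ᵗ b → pull ρ a ≡ᵗ pull ρ b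
  ≡ᵗ-pull ρ e φ h = ⊨-ren⁻ ρ ≈-refl φ (e (ren ρ φ) (⊨-ren⁺ ρ ≈-refl φ h))

  ≡ᵗ-≈ : ∀ {Γ : Ctx} {a a′ b b′ : Val Γ} → a ≈ᵛ a′ → b ≈ᵛ b′ → a ≡ᵗ b → a′ ≡ᵗ b′
  ≡ᵗ-≈ p q e φ h = ⊨-cong q φ (e φ (⊨-cong (≈-sym p) φ h))

  abstract

    -- The step of back and forth. If finitely many formulas true of e, c had no solution over e′,
    -- the universal closure of the negated conjunction would hold at e′, hence at e, and c would
    -- refute it.
    transfer : ∀ {P : Ctx} {w} {e e′ : Val P} → e ≡ᵗ e′ → (c : Tuple w) → ∃[ c′ ] (e & c) ≡ᵗ (e′ & c′)
    transfer {P} {w} {e} {e′} e≡e′ c = compactness def sat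
      where
      D : Formula (P ⊕ ⟨ w ⟩) → Tuple w → Set₁
      D φ c′ = e & c ⊨ φ → e′ & c′ ⊨ φ
      def : ∀ φ → Definable (D φ)
      def φ = def-→ (def-const _) (def-param e′ (def-⊨ φ (λ _ → inj₂) (λ _ → inj₁)))
      sat : ∀ φs → ∃[ c′ ] All (λ φ → D φ c′) φs
      sat φs with select (λ φ → e & c ⊨ φ) φs
      ... | ψs , true , implies = dne λ n →
        lower (alls-elim w (~ ⋀ ψs) (≡ᵗ-sym e≡e′ (alls w (~ ⋀ ψs)) (alls-intro w (~ ⋀ ψs) λ c′ h →
          ⊥-elim (n (c′ , implies (⋀-elim ψs h))))) c (⋀-intro true))

    -- `Algebraic` speaks of single formulas. If no formula of the type has all its solutions in a
    -- given finite list, compactness yields a realization of the whole type outside that list.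
    nonalgebraic⇒infinite : ∀ {A : Ctx} {y} {d : Tuple y} {a : Val A} → ¬ Algebraic (tp d a) a → Infinite (Realizes (tp d a) a)
    nonalgebraic⇒infinite {A} {y} {d} {a} ¬alg (as , cover) = let b , h = compactness def sat in proj₂ (h ⊤ᶠ) (cover b λ φ → proj₁ (h φ))
      where
      D : Formula (⟨ y ⟩ ⊕ A) → Tuple y → Set₁
      D φ b = (d & a ⊨ φ → b & a ⊨ φ) × ¬ Any (b ≈ᵛ_) as
      def : ∀ φ → Definable (D φ)
      def φ = def-× (def-→ (def-const _) (def-⊨-param φ a)) (def-¬ (def-Any (λ c → def-param c (def-≈ (λ _ → inj₁) (λ _ → inj₂))) as))
      sat : ∀ φs → ∃[ b ] All (λ φ → D φ b) φs
      sat φs with select (λ φ → d & a ⊨ φ) φs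
      ... | ψs , true , implies = dne λ n → ¬alg (⋀ ψs , ⋀-intro true , as , λ b h → dne λ far →
        n (b , All.map (λ k → k , far) (implies (⋀-elim ψs h))))

    -- Strong dividing speaks of all realizations of a type, a rank of the solutions of one formula
    -- π. If every formula of the type had k distinct solutions with a common b, compactness would
    -- give k distinct realizations of the type with a common b.
    inconsistent⇒formula : ∀ {A : Ctx} {x y} {δ : Formula (⟨ x ⟩ ⊕ ⟨ y ⟩)} {d : Tuple y} {a : Val A} {k} →
                           Inconsistent k δ (Realizes (tp d a) a) →
                           ∃[ π ] d & a ⊨ π × Inconsistent k δ (λ b → b & a ⊨ π)
    inconsistent⇒formula {A} {x} {y} {δ} {d} {a} {k} inc = dne λ n →
      let v , h = compactness def (sat n)
      in inc (λ i → tuple i v) (λ i φ → proj₁ (h φ) i) (proj₂ (proj₂ (h ⊤ᶠ))) (fst v , proj₁ (proj₂ (h ⊤ᶠ)))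
      where
      Y : Ctx
      Y s = Fin k × s ∈ y
      at : Fin k → Ren ⟨ y ⟩ (⟨ x ⟩ ⊕ Y)
      at i s v = inj₂ (i , v)
      tuple : Fin k → Val (⟨ x ⟩ ⊕ Y) → Tuple y
      tuple i = pull (at i)
      D : Formula (⟨ y ⟩ ⊕ A) → Val (⟨ x ⟩ ⊕ Y) → Set₁
      D φ v = (∀ i → d & a ⊨ φ → tuple i v & a ⊨ φ) × (∀ i → fst v & tuple i v ⊨ δ) ×
              (∀ i j → ¬ i ≡ j → ¬ tuple i v ≈ᵛ tuple j v)
      def : ∀ φ → Definable (D φ)
      def φ = def-× (def-Fin λ i → def-→ (def-const _) (def-pull (at i) (def-⊨-param φ a)))
             (def-× (def-Fin λ i → def-⊨ δ (λ _ → inj₁) (at i))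
                    (def-Fin λ i → def-Fin λ j → def-guard (def-¬ (def-≈ (at i) (at j)))))
      sat : ¬ (∃[ π ] d & a ⊨ π × Inconsistent k δ (λ b → b & a ⊨ π)) → ∀ φs → ∃[ v ] All (λ φ → D φ v) φs
      sat n φs with select (λ φ → d & a ⊨ φ) φs
      ... | ψs , true , implies
        with b , m ← ¬∀⇒∃¬ {B = λ b → ¬ AtLeast k (λ c → (c & a ⊨ ⋀ ψs) × (b & c ⊨ δ))} (λ none →
          n (⋀ ψs , ⋀-intro true , ¬AtLeast⇒Inconsistent {δ = δ} {P = λ c → c & a ⊨ ⋀ ψs} none))
        with as , ps , ds ← dne m = (b & λ s (i , v) → as i s v) ,
          All.tabulate (λ {φ} φ∈ → (λ i → All.lookup (implies (⋀-elim ψs (proj₁ (ps i)))) φ∈) ,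
            (λ i → ⊨-cong (λ { s (inj₁ _) → Dom.refl s ; s (inj₂ _) → Dom.refl s }) δ (proj₂ (ps i))) , ds)

-- Þ-ranks of definable sets

module Ranks (em : ∀ {ℓ} → ExcludedMiddle ℓ) {L : Language} (N : Structure L) where
  open Thorn N
  open Classical em
  open Valuations N
  open Infinity em N

  conj : ∀ {x y} {P : Ctx} → Formula (⟨ x ⟩ ⊕ P) → Formula (⟨ x ⟩ ⊕ ⟨ y ⟩) → Formula (⟨ x ⟩ ⊕ (P ⊕ ⟨ y ⟩))
  conj φ δ = ren (λ _ → [ inj₁ , inj₂ ∘ inj₁ ]) φ ∧ ren (λ _ → [ inj₁ , inj₂ ∘ inj₂ ]) δ

  module _ {x y} {P : Ctx} (φ : Formula (⟨ x ⟩ ⊕ P)) (δ : Formula (⟨ x ⟩ ⊕ ⟨ y ⟩)) {e : Val P} {a : Tuple y} {b : Tuple x} where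

    conj-elim : b & (e & a) ⊨ conj φ δ → b & e ⊨ φ × b & a ⊨ δ
    conj-elim (h , k) = ⊨-ren⁻ _ (λ { s (inj₁ _) → Dom.refl s ; s (inj₂ _) → Dom.refl s }) φ h
                      , ⊨-ren⁻ _ (λ { s (inj₁ _) → Dom.refl s ; s (inj₂ _) → Dom.refl s }) δ k

    conj-intro : b & e ⊨ φ → b & a ⊨ δ → b & (e & a) ⊨ conj φ δ
    conj-intro h k = ⊨-ren⁺ _ (λ { s (inj₁ _) → Dom.refl s ; s (inj₂ _) → Dom.refl s }) φ h
                   , ⊨-ren⁺ _ (λ { s (inj₁ _) → Dom.refl s ; s (inj₂ _) → Dom.refl s }) δ k

  module _ {x y : List Sort} {z : Ctx}
           (Δ : List (Formula (⟨ x ⟩ ⊕ ⟨ y ⟩))) (Π : List (Formula (⟨ y ⟩ ⊕ z))) (k : ℕ) where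

    -- The rank depends only on the set defined by the formula.
    R : Ordinal → Pred (Tuple x) 1ℓ → Set₁
    R zero    X = ∃[ b ] X b
    R (suc α) X =
      Σ[ δ ∈ Formula (⟨ x ⟩ ⊕ ⟨ y ⟩) ] δ ∈ Δ × Σ[ π ∈ Formula (⟨ y ⟩ ⊕ z) ] π ∈ Π × Σ[ c ∈ Val z ]
        Infinite (λ a → a & c ⊨ π × R α (λ b → X b × b & a ⊨ δ)) × Inconsistent k δ (λ a → a & c ⊨ π)
    R (sup I _ α) X = ∀ i → R (α i) X

    R-mono : ∀ α {X Y : Pred (Tuple x) 1ℓ} → (∀ b → X b → Y b) → R α X → R α Y
    R-mono zero    f (b , h) = b , f b h
    R-mono (suc α) f (δ , δ∈ , π , π∈ , c , inf , inc) = δ , δ∈ , π , π∈ , c ,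
      inf ∘ Finite-mono (λ a (p , r) → p , R-mono α (λ b (h , k) → f b h , k) r) , inc
    R-mono (sup I _ α) f r i = R-mono (α i) f (r i)

    mutual
      rank⇒R : ∀ {P : Ctx} α (φ : Formula (⟨ x ⟩ ⊕ P)) (e : Val P) → RankAtLeast Δ Π k α φ e → R α (λ b → b & e ⊨ φ)
      rank⇒R zero        φ e r = r
      rank⇒R (suc α)     φ e (δ , δ∈ , π , π∈ , c , inf , inc) = δ , δ∈ , π , π∈ , c ,
        inf ∘ Finite-mono (λ a (p , r) → p , R-mono α (λ b → conj-elim φ δ) (rank⇒R α (conj φ δ) (e & a) r)) , inc
      rank⇒R (sup I _ α) φ e r i = rank⇒R (α i) φ e (r i)

      R⇒rank : ∀ {P : Ctx} α (φ : Formula (⟨ x ⟩ ⊕ P)) (e : Val P) → R α (λ b → b & e ⊨ φ) → RankAtLeast Δ Π k α φ e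
      R⇒rank zero        φ e r = r
      R⇒rank (suc α)     φ e (δ , δ∈ , π , π∈ , c , inf , inc) = δ , δ∈ , π , π∈ , c ,
        inf ∘ Finite-mono (λ a (p , r) → p , R⇒rank α (conj φ δ) (e & a) (R-mono α (λ b (h , k) → conj-intro φ δ h k) r)) , inc
      R⇒rank (sup I _ α) φ e r i = R⇒rank (α i) φ e (r i)

    R⇒consistent : ∀ α {X : Pred (Tuple x) 1ℓ} → R α X → ∃[ b ] X b
    R⇒consistent zero        r = r
    R⇒consistent (suc α)     (_ , _ , _ , _ , _ , inf , _) with Infinite⇒∃ inf
    ... | a , _ , r with R⇒consistent α r
    ...   | b , h , _ = b , h
    R⇒consistent (sup I i α) r = R⇒consistent (α i) (r i)

    -- The comparison is relative to `Δ`, `Π` and `k`: α is below β when rank at least β always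
    -- entails rank at least α.
    _⊑_ : Ordinal → Ordinal → Set₂
    α ⊑ β = ∀ X → R β X → R α X

    ⊑-suc : ∀ α β → α ⊑ β → suc α ⊑ suc β
    ⊑-suc α β le X (δ , δ∈ , π , π∈ , c , inf , inc) = δ , δ∈ , π , π∈ , c , inf ∘ Finite-mono (λ a (p , r) → p , le _ r) , inc

    ⊑-sup : ∀ {I} i₀ (α : I → Ordinal) β → ¬ (∃[ i ] β ⊑ α i) → (∀ i → β ⊑ α i ⊎ α i ⊑ β) → sup I i₀ α ⊑ β
    ⊑-sup i₀ α β n t X r i with t i
    ... | inj₁ le = ⊥-elim (n (i , le))
    ... | inj₂ ge = ge X r

    -- A supremum either has a member above the other ordinal or, by induction, only members below
    -- it.
    total : ∀ α β → α ⊑ β ⊎ β ⊑ α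
    total zero    β    = inj₁ λ X → R⇒consistent β
    total (suc α) zero = inj₂ λ X → R⇒consistent (suc α)
    total (suc α) (suc β) with total α β
    ... | inj₁ le = inj₁ (⊑-suc α β le)
    ... | inj₂ ge = inj₂ (⊑-suc β α ge)
    total (suc α) (sup I i₀ β) with em {P = ∃[ i ] suc α ⊑ β i}
    ... | yes (i , le) = inj₁ λ X r → le X (r i)
    ... | no n         = inj₂ (⊑-sup i₀ β (suc α) n λ i → total (suc α) (β i))
    total (sup I i₀ α) β with em {P = ∃[ i ] β ⊑ α i}
    ... | yes (i , le) = inj₂ λ X r → le X (r i)
    ... | no n         = inj₁ (⊑-sup i₀ α β n λ i → swap (total (α i) β))

    -- At successors, an infinite set of tuples split in two has an infinite half. At suprema, if X
    -- fails at `α i` and Y at `α j`, the larger of the two ordinals, which exists by `total`,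
    -- contradicts the induction hypothesis.
    R-⊎ : ∀ α {X Y Z : Pred (Tuple x) 1ℓ} → (∀ b → Z b → X b ⊎ Y b) → R α Z → R α X ⊎ R α Y
    R-⊎ zero f (b , h) with f b h
    ... | inj₁ p = inj₁ (b , p)
    ... | inj₂ q = inj₂ (b , q)
    R-⊎ (suc α) {X} {Y} f (δ , δ∈ , π , π∈ , c , inf , inc) with em {P = Finite (λ a → a & c ⊨ π × R α (λ b → X b × b & a ⊨ δ))}
    ... | no infX  = inj₁ (δ , δ∈ , π , π∈ , c , infX , inc)
    ... | yes finX = inj₂ (δ , δ∈ , π , π∈ , c , (λ finY → inf (Finite-⊎ split finX finY)) , inc)
      where
      split : ∀ a → _ → _
      split a (p , r) with R-⊎ α (λ b (h , k) → [ (λ x → inj₁ (x , k)) , (λ y → inj₂ (y , k)) ] (f b h)) r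
      ... | inj₁ l = inj₁ (p , l)
      ... | inj₂ l = inj₂ (p , l)
    R-⊎ (sup I i₀ α) {X} {Y} f r with em {P = ∀ i → R (α i) X} | em {P = ∀ i → R (α i) Y}
    ... | yes h | _     = inj₁ h
    ... | _     | yes h = inj₂ h
    ... | no m  | no n with ¬∀⇒∃¬ m | ¬∀⇒∃¬ n
    ...   | i , ¬X | j , ¬Y with total (α i) (α j)
    ...     | inj₁ le = [ (λ h → ⊥-elim (¬X (le X h))) , (λ h → ⊥-elim (¬Y h)) ] (R-⊎ (α j) f (r j))
    ...     | inj₂ ge = [ (λ h → ⊥-elim (¬X h)) , (λ h → ⊥-elim (¬Y (ge Y h))) ] (R-⊎ (α i) f (r i))

    R-Any : ∀ α {I : Set₁} {X : Pred (Tuple x) 1ℓ} {Y : I → Pred (Tuple x) 1ℓ} is →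
            (∀ b → X b → Any (λ i → Y i b) is) → R α X → Any (λ i → R α (Y i)) is
    R-Any α [] f r with R⇒consistent α r
    ... | b , h with f b h
    ...   | ()
    R-Any α {Y = Y} (i ∷ is) f r with R-⊎ α {Y i} {λ b → Any (λ i → Y i b) is} (λ b h → Any.toSum (f b h)) r
    ... | inj₁ h = here h
    ... | inj₂ h = there (R-Any α is (λ b → id) h)

module Invariance (em : ∀ {ℓ} → ExcludedMiddle ℓ) {L : Language} (N : Structure L) (saturated : Saturated N) where
  open Thorn N
  open Classical em
  open Valuations N
  open Infinity em N
  open TypeLemmas em N saturated
  open Ranks em N

  -- Each tuple found joins the parameters, so that the next one is found distinct from it. `X` and
  -- `X′` need not be definable: they only have to correspond along tuples of equal type.
  AtLeast-transfer : ∀ {P : Ctx} {y} k {e e′ : Val P} {X X′ : Pred (Tuple y) 1ℓ} → e ≡ᵗ e′ →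
                     (∀ a a′ → (e & a) ≡ᵗ (e′ & a′) → X a → X′ a′) → AtLeast k X → AtLeast k X′
  AtLeast-transfer zero    eq f _ = (λ ()) , (λ ()) , λ ()
  AtLeast-transfer {P} {y} (suc k) {e} {e′} {X} {X′} eq f h with uncons {P = X} h
  ... | a , p , h′ with transfer {P} {y} {e} {e′} eq a
  ...   | a′ , eq′ = cons {P = X′} a′ (f a a′ eq′ p)
          (AtLeast-transfer {P ⊕ ⟨ y ⟩} {y} k {e & a} {e′ & a′} {λ b → X b × ¬ b ≈ᵛ a} {λ b → X′ b × ¬ b ≈ᵛ a′} eq′ f′ h′)
    where
    distinct : Formula (P ⊕ ⟨ y ⟩ ⊕ ⟨ y ⟩)
    distinct = ~ eqᶠ y (λ _ → inj₂) (λ _ → inj₁ ∘ inj₂)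
    f′ : ∀ b b′ → (e & a & b) ≡ᵗ (e′ & a′ & b′) → X b × ¬ b ≈ᵛ a → X′ b′ × ¬ b′ ≈ᵛ a′
    f′ b b′ eq″ (q , n) =
      f b b′ (≡ᵗ-≈ (same e a b) (same e′ a′ b′) (≡ᵗ-pull ρ eq″)) q ,
      λ e₁ → lower (eq″ distinct (λ h → Level.lift (n (eqᶠ-sound y _ _ {b = e & a & b} h)))
                                 (eqᶠ-complete y _ _ {b = e′ & a′ & b′} e₁))
      where
      ρ : Ren (P ⊕ ⟨ y ⟩) (P ⊕ ⟨ y ⟩ ⊕ ⟨ y ⟩)
      ρ s = [ inj₁ ∘ inj₁ , inj₂ ]
      same : ∀ (d : Val P) u v → pull ρ (d & u & v) ≈ᵛ (d & v)
      same d u v s (inj₁ _) = Dom.refl s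
      same d u v s (inj₂ _) = Dom.refl s

  module _ {x y w} (Δ : List (Formula (⟨ x ⟩ ⊕ ⟨ y ⟩))) (Π : List (Formula (⟨ y ⟩ ⊕ ⟨ w ⟩))) (k : ℕ) where

    -- Back and forth along the definition of the rank. The parameters c and the infinitely many
    -- tuples a are moved forwards; k-inconsistency is negative, so a counterexample to it is moved
    -- backwards. `P` is arbitrary because it grows by `y` at each step.
    R-invariant : ∀ α {P : Ctx} (φ : Formula (⟨ x ⟩ ⊕ P)) {e e′ : Val P} → e ≡ᵗ e′ →
                  R Δ Π k α (λ b → b & e ⊨ φ) → R Δ Π k α (λ b → b & e′ ⊨ φ)
    R-invariant zero {P} φ {e} {e′} eq (b , h) with transfer eq b
    ... | b′ , eq′ = b′ , ⊨-ren⁻ ρ (same e′ b′) φ (eq′ (ren ρ φ) (⊨-ren⁺ ρ (same e b) φ h))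
      where
      ρ : Ren (⟨ x ⟩ ⊕ P) (P ⊕ ⟨ x ⟩)
      ρ s = [ inj₂ , inj₁ ]
      same : ∀ e b → (b & e) ≈[ ρ ] (e & b)
      same e b s (inj₁ _) = Dom.refl s
      same e b s (inj₂ _) = Dom.refl s
    R-invariant (sup I _ α) φ eq r i = R-invariant (α i) φ eq (r i)
    R-invariant (suc α) {P} φ {e} {e′} eq (δ , δ∈ , π , π∈ , c , inf , inc) with transfer eq c
    ... | c′ , eq′ = δ , δ∈ , π , π∈ , c′ , ¬Finite (λ n → AtLeast-transfer n eq′ step (Infinite⇒AtLeast inf n)) ,
                     ¬AtLeast⇒Inconsistent {δ = δ} {P = λ a → a & c′ ⊨ π} inc′
      where
      ρ : Ren (⟨ y ⟩ ⊕ ⟨ w ⟩) (P ⊕ ⟨ w ⟩ ⊕ ⟨ y ⟩)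
      ρ s = [ inj₂ , inj₁ ∘ inj₂ ]
      same : ∀ (e : Val P) c a → (a & c) ≈[ ρ ] (e & c & a)
      same e c a s (inj₁ _) = Dom.refl s
      same e c a s (inj₂ _) = Dom.refl s
      σ : Ren (P ⊕ ⟨ y ⟩) (P ⊕ ⟨ w ⟩ ⊕ ⟨ y ⟩)
      σ s = [ inj₁ ∘ inj₁ , inj₂ ]
      sameσ : ∀ (e : Val P) c a → pull σ (e & c & a) ≈ᵛ (e & a)
      sameσ e c a s (inj₁ _) = Dom.refl s
      sameσ e c a s (inj₂ _) = Dom.refl s
      step : ∀ a a′ → (e & c & a) ≡ᵗ (e′ & c′ & a′) → a & c ⊨ π × R Δ Π k α (λ b → b & e ⊨ φ × b & a ⊨ δ) →
             a′ & c′ ⊨ π × R Δ Π k α (λ b → b & e′ ⊨ φ × b & a′ ⊨ δ)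
      step a a′ eq″ (p , r) = ⊨-ren⁻ ρ (same e′ c′ a′) π (eq″ (ren ρ π) (⊨-ren⁺ ρ (same e c a) π p)) ,
        R-mono Δ Π k α (λ b → conj-elim φ δ)
          (R-invariant α (conj φ δ) (≡ᵗ-≈ (sameσ e c a) (sameσ e′ c′ a′) (≡ᵗ-pull σ eq″))
            (R-mono Δ Π k α (λ b (h , h′) → conj-intro φ δ h h′) r))
      inc′ : ∀ b′ → ¬ AtLeast k (λ a → (a & c′ ⊨ π) × (b′ & a ⊨ δ))
      inc′ b′ h with transfer (≡ᵗ-sym eq′) b′
      ... | b , eq″ = Inconsistent⇒¬AtLeast {δ = δ} {P = λ a → a & c ⊨ π} inc b (AtLeast-transfer k eq″ back h)
        where
        τ : Ren (⟨ y ⟩ ⊕ ⟨ w ⟩) (P ⊕ ⟨ w ⟩ ⊕ ⟨ x ⟩ ⊕ ⟨ y ⟩)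
        τ s = [ inj₂ , inj₁ ∘ inj₁ ∘ inj₂ ]
        sameτ : ∀ (e : Val P) c b a → (a & c) ≈[ τ ] (e & c & b & a)
        sameτ e c b a s (inj₁ _) = Dom.refl s
        sameτ e c b a s (inj₂ _) = Dom.refl s
        υ : Ren (⟨ x ⟩ ⊕ ⟨ y ⟩) (P ⊕ ⟨ w ⟩ ⊕ ⟨ x ⟩ ⊕ ⟨ y ⟩)
        υ s = [ inj₁ ∘ inj₂ , inj₂ ]
        sameυ : ∀ (e : Val P) (c : Tuple w) b a → (b & a) ≈[ υ ] (e & c & b & a)
        sameυ e c b a s (inj₁ _) = Dom.refl s
        sameυ e c b a s (inj₂ _) = Dom.refl s
        back : ∀ a′ a → (e′ & c′ & b′ & a′) ≡ᵗ (e & c & b & a) → a′ & c′ ⊨ π × b′ & a′ ⊨ δ → a & c ⊨ π × b & a ⊨ δ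
        back a′ a eq‴ (p , q) = ⊨-ren⁻ τ (sameτ e c b a) π (eq‴ (ren τ π) (⊨-ren⁺ τ (sameτ e′ c′ b′ a′) π p)) ,
                                ⊨-ren⁻ υ (sameυ e c b a) δ (eq‴ (ren υ δ) (⊨-ren⁺ υ (sameυ e′ c′ b′ a′) δ q))

-- From rosiness to local character

module Packing (em : ∀ {ℓ} → ExcludedMiddle ℓ) {L : Language} (N : Structure L) (saturated : Saturated N) where
  open Thorn N
  open Classical em
  open Valuations N
  open Support N
  open TypeLemmas em N saturated

  inˡ : ∀ v w → Ren ⟨ v ⟩ ⟨ v ++ w ⟩
  inˡ v w _ = ∈-++⁺ˡ

  inʳ : ∀ v w → Ren ⟨ w ⟩ ⟨ v ++ w ⟩
  inʳ v w _ = ∈-++⁺ʳ v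

  join-≈ : ∀ v w {a a′ : Tuple (v ++ w)} → pull (inˡ v w) a ≈ᵛ pull (inˡ v w) a′ →
           pull (inʳ v w) a ≈ᵛ pull (inʳ v w) a′ → a ≈ᵛ a′
  join-≈ []      w e f s i           = f s i
  join-≈ (_ ∷ v) w e f s (here refl) = e s (here refl)
  join-≈ (_ ∷ v) w e f s (there i)   = join-≈ v w (λ t j → e t (there j)) f s i

  join-≈ˡ : ∀ {v w} (a : Tuple v) (c : Tuple w) → pull (inˡ v w) (join a c) ≈ᵛ a
  join-≈ˡ a c s i = ≡⇒≈ (join-ˡ a c s i)

  join-≈ʳ : ∀ {v w} (a : Tuple v) (c : Tuple w) → pull (inʳ v w) (join a c) ≈ᵛ c
  join-≈ʳ a c s i = ≡⇒≈ (join-ʳ a c s i)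

  module _ {x : List Sort} {A : Ctx} (a₀ : Val A) where

    -- What the rank argument takes from the þ-dividing of δ(x , d). The tuples a are not themselves
    -- asked to be conjugates of d, only to satisfy that δ̂(x , a) follows from δ(x , d′) for a
    -- conjugate d′; thus a may be longer than d.
    record Uniform {y z} (u : Tuple z) (k : ℕ) (δ̂ : Formula (⟨ x ⟩ ⊕ ⟨ y ⟩)) (π : Formula (⟨ y ⟩ ⊕ ⟨ z ⟩))
                   (i : Instance x) : Set₁ where
      constructor uniform
      open Instance i using (δ; d)
      field
        inconsistent : Inconsistent k δ̂ (λ a → a & u ⊨ π)
        infinite     : Infinite (λ a → a & u ⊨ π × ∃[ d′ ] (a₀ & d) ≡ᵗ (a₀ & d′) × (∀ b → b & d′ ⊨ δ → b & a ⊨ δ̂))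

    -- Adds dummy coordinates to the tuple of variables y.  They are fixed by
    -- parameters, since otherwise k-inconsistency would be lost.
    module Pad {y v y′ z z′ : List Sort} (ι : Ren ⟨ y ⟩ ⟨ y′ ⟩) (κ : Ren ⟨ v ⟩ ⟨ y′ ⟩)
               (ζ : Ren ⟨ z ⟩ ⟨ z′ ⟩) (η : Ren ⟨ v ⟩ ⟨ z′ ⟩) where

      padδ : Formula (⟨ x ⟩ ⊕ ⟨ y ⟩) → Formula (⟨ x ⟩ ⊕ ⟨ y′ ⟩)
      padδ = ren (⊕-ren (λ _ → id) ι)

      padπ : Formula (⟨ y ⟩ ⊕ ⟨ z ⟩) → Formula (⟨ y′ ⟩ ⊕ ⟨ z′ ⟩)
      padπ π = ren (⊕-ren ι ζ) π ∧ eqᶠ v (λ s → inj₁ ∘ κ s) (λ s → inj₂ ∘ η s)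

      module _ (glue : Tuple y → Tuple v → Tuple y′)
               (glue-ι : ∀ a c → pull ι (glue a c) ≈ᵛ a) (glue-κ : ∀ a c → pull κ (glue a c) ≈ᵛ c)
               (joint : ∀ {a a′ : Tuple y′} → pull ι a ≈ᵛ pull ι a′ → pull κ a ≈ᵛ pull κ a′ → a ≈ᵛ a′)
               {u : Tuple z} {t : Tuple v} {u′ : Tuple z′} (ζ-u : pull ζ u′ ≈ᵛ u) (η-t : pull η u′ ≈ᵛ t) where

        padδ-same : ∀ {b : Tuple x} {a : Tuple y} {a′ : Tuple y′} → a ≈ᵛ pull ι a′ → (b & a) ≈[ ⊕-ren (λ _ → id) ι ] (b & a′)
        padδ-same e s (inj₁ _) = Dom.refl s
        padδ-same e s (inj₂ i) = e s i

        padπ-same : ∀ {a : Tuple y} {a′ : Tuple y′} → a ≈ᵛ pull ι a′ → (a & u) ≈[ ⊕-ren ι ζ ] (a′ & u′)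
        padπ-same e s (inj₁ i) = e s i
        padπ-same e s (inj₂ i) = Dom.sym s (ζ-u s i)

        pad : ∀ {k l δ̂ π i} → k ≤ l → Uniform u k δ̂ π i → Uniform u′ l (padδ δ̂) (padπ π) i
        pad {k} {l} {δ̂} {π} {i} k≤l (uniform inc inf) =
            uniform (Inconsistent-≤ {δ = padδ δ̂} {P = λ a → a & u′ ⊨ padπ π} k≤l inc′) inf′
          where
          κ-fixed : ∀ a → a & u′ ⊨ padπ π → pull κ a ≈ᵛ t
          κ-fixed a (_ , e) = ≈-trans (eqᶠ-sound v _ _ {b = a & u′} e) η-t
          inc′ : Inconsistent k (padδ δ̂) (λ a → a & u′ ⊨ padπ π)
          inc′ as ps ds (b , bs) = inc (λ i → pull ι (as i)) (λ i → ⊨-ren⁻ _ (padπ-same ≈-refl) π (proj₁ (ps i)))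
            -- The dummy coordinates are the same in all solutions, so distinct solutions differ in
            -- the genuine ones.
            (λ i j n e → ds i j n (joint e (≈-trans (κ-fixed (as i) (ps i)) (≈-sym (κ-fixed (as j) (ps j))))))
            (b , λ i → ⊨-ren⁻ _ (padδ-same ≈-refl) δ̂ (bs i))
          inf′ : Infinite _
          inf′ (cs , cover) = inf (map (pull ι) cs , λ { a (p , d′ , eq , imp) →
            map⁺ (Any.map (λ e → ≈-trans (≈-sym (glue-ι a t)) (λ s v → e s (ι s v)))
            (cover (glue a t)
              ( (⊨-ren⁺ _ (padπ-same (≈-sym (glue-ι a t))) π p
                , eqᶠ-complete v _ _ {b = glue a t & u′} (≈-trans (glue-κ a t) (≈-sym η-t)))
              , d′ , eq , λ b h → ⊨-ren⁺ _ (padδ-same (≈-sym (glue-ι a t))) δ̂ (imp b h)))) })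

    -- `t` supplies the values of the dummy coordinates for instances that are added later.
    record Packed (is : List (Instance x)) : Set₁ where
      constructor packed
      field
        {y z} : List Sort
        t     : Tuple y
        u     : Tuple z
        k     : ℕ
        Δ     : List (Formula (⟨ x ⟩ ⊕ ⟨ y ⟩))
        Π     : List (Formula (⟨ y ⟩ ⊕ ⟨ z ⟩))
        each  : All (λ i → Σ[ δ ∈ Formula (⟨ x ⟩ ⊕ ⟨ y ⟩) ] δ ∈ Δ × Σ[ π ∈ Formula (⟨ y ⟩ ⊕ ⟨ z ⟩) ] π ∈ Π × Uniform u k δ π i) is

    abstract

      pack : ∀ {is} → All (λ (inst δ d) → ThornDivides δ d a₀) is → Packed is
      pack [] = packed {y = []} {z = []} (λ _ ()) (λ _ ()) 0 [] [] []
      pack {inst {y₀} δ d ∷ is} ((C , c , ¬alg , k₀ , inc) ∷ ds) with pack ds | inconsistent⇒formula {δ = δ} {d = d} {a = a₀ & c} inc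
      ... | packed {y} {z} t u k Δ Π each | π , d⊨π , inc₀ with parameter-support π
      ...   | psupp {w₀} ρ π₀ sound complete = packed (join d t) u′ (k₀ ⊔ k)
              (Head.padδ δ ∷ map Tail.padδ Δ) (Head.padπ π₀ ∷ map Tail.padπ Π)
              ((Head.padδ δ , here refl , Head.padπ π₀ , here refl ,
                 Head.pad join join-≈ˡ join-≈ʳ (join-≈ y₀ y) {u′ = u′} ζ₀-u η₀-t (m≤m⊔n k₀ k) head)
               ∷ All.map (λ { (δ , δ∈ , π , π∈ , un) → Tail.padδ δ , there (∈-map⁺ _ δ∈) , Tail.padπ π , there (∈-map⁺ _ π∈) ,
                   Tail.pad (λ a c → join c a) (λ a c → join-≈ʳ c a) (λ a c → join-≈ˡ c a) (λ e f → join-≈ y₀ y f e)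
                     {u′ = u′} ζ₁-u η₁-t (m≤n⊔m k₀ k) un }) each)
        where
        u₀ : Tuple w₀
        u₀ = pull ρ (a₀ & c)
        -- The parameters of the new formula and of the earlier ones, then the dummy values: `t`
        -- pads the new instance and `d` pads the earlier ones.
        u′ : Tuple ((w₀ ++ z) ++ (y₀ ++ y))
        u′ = join (join u₀ u) (join d t)
        ζ₀ : Ren ⟨ w₀ ⟩ ⟨ (w₀ ++ z) ++ (y₀ ++ y) ⟩
        ζ₀ s i = ∈-++⁺ˡ (∈-++⁺ˡ i)
        ζ₁ : Ren ⟨ z ⟩ ⟨ (w₀ ++ z) ++ (y₀ ++ y) ⟩
        ζ₁ s i = ∈-++⁺ˡ (∈-++⁺ʳ w₀ i)
        η₀ : Ren ⟨ y ⟩ ⟨ (w₀ ++ z) ++ (y₀ ++ y) ⟩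
        η₀ s i = ∈-++⁺ʳ (w₀ ++ z) (∈-++⁺ʳ y₀ i)
        η₁ : Ren ⟨ y₀ ⟩ ⟨ (w₀ ++ z) ++ (y₀ ++ y) ⟩
        η₁ s i = ∈-++⁺ʳ (w₀ ++ z) (∈-++⁺ˡ i)
        ζ₀-u : pull ζ₀ u′ ≈ᵛ u₀
        ζ₀-u s i = Dom.trans s (join-≈ˡ (join u₀ u) (join d t) s _) (join-≈ˡ u₀ u s i)
        ζ₁-u : pull ζ₁ u′ ≈ᵛ u
        ζ₁-u s i = Dom.trans s (join-≈ˡ (join u₀ u) (join d t) s _) (join-≈ʳ u₀ u s i)
        η₀-t : pull η₀ u′ ≈ᵛ t
        η₀-t s i = Dom.trans s (join-≈ʳ (join u₀ u) (join d t) s _) (join-≈ʳ d t s i)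
        η₁-t : pull η₁ u′ ≈ᵛ d
        η₁-t s i = Dom.trans s (join-≈ʳ (join u₀ u) (join d t) s _) (join-≈ˡ d t s i)
        module Head = Pad {y₀} {y} {y₀ ++ y} (inˡ y₀ y) (inʳ y₀ y) ζ₀ η₀
        module Tail = Pad {y} {y₀} {y₀ ++ y} (inʳ y₀ y) (inˡ y₀ y) ζ₁ η₁
        σ : Ren (A ⊕ ⟨ y₀ ⟩) (⟨ y₀ ⟩ ⊕ (A ⊕ C))
        σ s = [ inj₂ ∘ inj₁ , inj₁ ]
        σ-same : ∀ d → pull σ (d & (a₀ & c)) ≈ᵛ (a₀ & d)
        σ-same d s (inj₁ _) = Dom.refl s
        σ-same d s (inj₂ _) = Dom.refl s
        -- Realizations of the type of d over a₀ and c are conjugates of d over a₀, and each serves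
        -- as its own d′.
        head : Uniform u₀ k₀ δ π₀ (inst δ d)
        head = uniform (Inconsistent-mono {δ = δ} {P = λ b → b & (a₀ & c) ⊨ π}
                         {Q = λ b → b & u₀ ⊨ π₀} (λ b → sound b (a₀ & c)) inc₀)
          (nonalgebraic⇒infinite ¬alg ∘ Finite-mono (λ b same → complete b (a₀ & c) (same π d⊨π) , b ,
            ≡ᵗ-≈ (σ-same d) (σ-same b) (≡ᵗ-pull σ {a = d & (a₀ & c)} {b = b & (a₀ & c)} same) , λ _ → id))

module RosyImpliesLocalCharacter (em : ∀ {ℓ} → ExcludedMiddle ℓ) {L : Language} (N : Structure L) (saturated : Saturated N) where
  open Thorn N
  open Classical em
  open Valuations N
  open Support N
  open Definability em N
  open Compactness em N saturated
  open TypeLemmas em N saturated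
  open Ranks em N
  open Invariance em N saturated
  open Packing em N saturated

  -- `w` is a finite list even though ranks allow an infinite `z`; this keeps the number of indices
  -- within |T|.
  Index : List Sort → Set
  Index x = Σ[ y ∈ List Sort ] Σ[ w ∈ List Sort ] (List (Formula (⟨ x ⟩ ⊕ ⟨ y ⟩)) × List (Formula (⟨ y ⟩ ⊕ ⟨ w ⟩)) × ℕ)

  module _ {x : List Sort} {A : Ctx} (a : Val A) (p : Partial ⟨ x ⟩ A) (ct : CompleteType p a) where
    open CompleteType ct

    ⋀-closed : ∀ {φs} → All p φs → p (⋀ φs)
    ⋀-closed {φs} ps with complete (⋀ φs)
    ... | inj₁ q = q
    ... | inj₂ q with consistent (~ ⋀ φs ∷ φs) (q ∷ ps)
    ...   | b , n ∷ hs = ⊥-elim (lower (n (⋀-intro hs)))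

    abstract

      implied : ∀ {D : Tuple x → Set₁} → Definable D → (∀ b → Realizes p a b → D b) → ∃[ φ ] p φ × (∀ b → b & a ⊨ φ → D b)
      implied {D} d h = dne λ n → let b , k = compactness def (sat n) in proj₂ (k ⊤ᶠ) (h b λ φ → proj₁ (k φ))
        where
        E : Formula (⟨ x ⟩ ⊕ A) → Tuple x → Set₁
        E φ b = (p φ → b & a ⊨ φ) × ¬ D b
        def : ∀ φ → Definable (E φ)
        def φ = def-× (def-→ (def-const (p φ)) (def-⊨-param φ a)) (def-¬ d)
        sat : ¬ (∃[ φ ] p φ × (∀ b → b & a ⊨ φ → D b)) → ∀ φs → ∃[ b ] All (λ φ → E φ b) φs
        sat n φs with select p φs
        ... | ψs , ps , implies = dne λ m → n (⋀ ψs , ⋀-closed ps , λ b k → dne λ ¬D →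
          m (b , All.map (λ q → q , ¬D) (implies (⋀-elim ψs k))))

    module _ {y w} (Δ : List (Formula (⟨ x ⟩ ⊕ ⟨ y ⟩))) (Π : List (Formula (⟨ y ⟩ ⊕ ⟨ w ⟩))) (k : ℕ) where

      record MinimalRank : Set₂ where
        constructor minimal
        field
          β     : Ordinal
          φ     : Formula (⟨ x ⟩ ⊕ A)
          φ∈p   : p φ
          upper : ¬ R Δ Π k (suc β) (λ b → b & a ⊨ φ)
          below : ∀ ψ → p ψ → R Δ Π k β (λ b → b & a ⊨ ψ)

      abstract

        -- Descent on a bound α. At `suc β` either all of p has rank at least β, or some member of p
        -- fails β and replaces φ. Zero is never reached, since p is consistent.
        minimal-rank : ∀ α φ → p φ → ¬ R Δ Π k α (λ b → b & a ⊨ φ) → MinimalRank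
        minimal-rank zero φ φ∈p n with consistent (φ ∷ []) (φ∈p ∷ [])
        ... | b , h ∷ [] = ⊥-elim (n (b , h))
        minimal-rank (suc β) φ φ∈p n with em {P = ∀ ψ → p ψ → R Δ Π k β (λ b → b & a ⊨ ψ)}
        ... | yes h = minimal β φ φ∈p n h
        ... | no m with ¬∀⇒∃¬ m
        ...   | ψ , m′ with ¬→⇒×¬ m′
        ...     | ψ∈p , m″ = minimal-rank β ψ ψ∈p m″
        minimal-rank (sup I _ α) φ φ∈p n with ¬∀⇒∃¬ n
        ... | i , m = minimal-rank (α i) φ φ∈p m

    module _ {A₀ : Ctx} (a₀ : Val A₀) {y w} (Δ : List (Formula (⟨ x ⟩ ⊕ ⟨ y ⟩))) (Π : List (Formula (⟨ y ⟩ ⊕ ⟨ w ⟩))) (k : ℕ)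
             (u : Tuple w) (m : MinimalRank Δ Π k) (φ₁ : Formula (⟨ x ⟩ ⊕ A₀))
             (φ⇒φ₁ : ∀ b → b & a ⊨ MinimalRank.φ m → b & a₀ ⊨ φ₁)
             (φ₁⇒φ : ∀ b → b & a₀ ⊨ φ₁ → b & a ⊨ MinimalRank.φ m) where
      open MinimalRank m

      -- As φ is equivalent to `φ₁` over a₀, the rank of φ ∧ δ₀(x , d) is inherited by every
      -- conjugate d′ of d over a₀, hence by φ ∧ δ(x , c) for infinitely many c; this contradicts
      -- `upper`.
      no-uniform-instance : ∀ i →
        Σ[ δ ∈ Formula (⟨ x ⟩ ⊕ ⟨ y ⟩) ] δ ∈ Δ × Σ[ π ∈ Formula (⟨ y ⟩ ⊕ ⟨ w ⟩) ] π ∈ Π × Uniform a₀ u k δ π i →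
        ¬ R Δ Π k β (λ b → b & a ⊨ φ × b & Instance.d i ⊨ Instance.δ i)
      no-uniform-instance (inst {y₀} δ₀ d) (δ , δ∈ , π , π∈ , uniform inc inf) r =
        upper (δ , δ∈ , π , π∈ , u , inf ∘ Finite-mono (λ c (h , d′ , eq , imp) → h , conjugate c d′ eq imp) , inc)
        where
        X : Tuple y₀ → Tuple x → Set₁
        X d b = b & (a₀ & d) ⊨ conj φ₁ δ₀
        conjugate : ∀ c d′ → (a₀ & d) ≡ᵗ (a₀ & d′) → (∀ b → b & d′ ⊨ δ₀ → b & c ⊨ δ) → R Δ Π k β (λ b → b & a ⊨ φ × b & c ⊨ δ)
        conjugate c d′ eq imp = R-mono Δ Π k β {X d′} (λ b g → let g₁ , g₂ = conj-elim φ₁ δ₀ g in φ₁⇒φ b g₁ , imp b g₂)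
          (R-invariant Δ Π k β (conj φ₁ δ₀) eq (R-mono Δ Π k β {Y = X d} (λ b (g₁ , g₂) → conj-intro φ₁ δ₀ (φ⇒φ₁ b g₁) g₂) r))

    abstract

      no-packing : ∀ {A₀ : Ctx} (a₀ : Val A₀) {is} (pk : Packed a₀ is) → let open Packed pk in
                   (∀ b → Realizes p a b → Any (λ (inst δ d) → b & d ⊨ δ) is) →
                   (m : MinimalRank Δ Π k) (φ₁ : Formula (⟨ x ⟩ ⊕ A₀)) →
                   (∀ b → b & a ⊨ MinimalRank.φ m → b & a₀ ⊨ φ₁) →
                   ¬ (∀ b → b & a₀ ⊨ φ₁ → b & a ⊨ MinimalRank.φ m)
      no-packing a₀ {is} (packed t u k Δ Π each) cover m@(minimal β φ φ∈p upper below) φ₁ f g =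
        let χ , χ∈p , χ⇒ = implied (def-Any {D = λ (inst δ d) b → b & d ⊨ δ} (λ (inst δ d) → def-⊨-param δ d) is) cover
            good , r = All.lookupAny each (R-Any Δ Π k β {Y = λ (inst δ d) b → b & a ⊨ φ × b & d ⊨ δ} is
              (λ b (h , h′ , _) → Any.map (λ q → h′ , q) (χ⇒ b h)) (below (⋀ (χ ∷ φ ∷ [])) (⋀-closed (χ∈p ∷ φ∈p ∷ []))))
        in no-uniform-instance a₀ Δ Π k u m φ₁ f g _ good r

  module _ (K : Set) (code : ∀ x (v : Index x → List Sort) → (Σ[ j ∈ Index x ] Σ[ s ∈ Sort ] s ∈ v j) ↣ K)
           (rosy : RanksDefined) where

    private
      abstract

        min : ∀ {x} {A : Ctx} (a : Val A) (p : Partial ⟨ x ⟩ A) (ct : CompleteType p a) →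
              ∀ (j : Index x) → let _ , _ , Δ , Π , k = j in MinimalRank a p ct Δ Π k
        min {x} {A} a p ct (y , w , Δ , Π , k) with rosy Δ Π k (⊤ᶠ {⟨ x ⟩ ⊕ A}) a
        ... | α , n = minimal-rank a p ct Δ Π k α ⊤ᶠ (⋀-closed a p ct []) (n ∘ R⇒rank Δ Π k α ⊤ᶠ a)

    localCharacter : ThornLocalCharacter K
    localCharacter {x} {A} a p ct = S , mk↣ injective , ¬forks
      where
      supp : ∀ j → ParameterSupport (MinimalRank.φ (min a p ct j))
      supp j = parameter-support (MinimalRank.φ (min a p ct j))
      open ParameterSupport
      S : Subset A
      -- A parameter is kept together with each place where it occurs; the place determines it,
      -- which makes the injection into `K` immediate.
      S s v = Σ[ j ∈ Index x ] Σ[ i ∈ s ∈ w (supp j) ] ρ (supp j) s i ≡ v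
      C : (Σ[ j ∈ Index x ] Σ[ s ∈ Sort ] s ∈ w (supp j)) ↣ K
      C = code x (λ j → w (supp j))
      to : Σ Sort (restrict A S) → K
      to (s , v , j , i , _) = Injection.to C (j , s , i)
      injective : ∀ {u v} → to u ≡ to v → u ≡ v
      injective {s , v , j , i , refl} {s′ , v′ , j′ , i′ , refl} e with Injection.injective C e
      ... | refl = refl
      ¬forks : ¬ TypeThornForks p a (a ↾ S)
      ¬forks (P , θ , e , p⊢θ , is , divide , cover) =
        no-packing a p ct (a ↾ S) pk (λ b r → cover b (p⊢θ b r)) (min a p ct j) (ren κ (φ₀ (supp j)))
          (λ b h → ⊨-ren⁺ κ (same b) (φ₀ (supp j)) (complete (supp j) b a h))
          (λ b h → sound (supp j) b a (⊨-ren⁻ κ (same b) (φ₀ (supp j)) h))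
        where
        pk = pack (a ↾ S) divide
        -- This index depends on `S` through the þ-dividing formulas, but `S` already contains the
        -- parameters for every index.
        j : Index x
        j = Packed.y pk , Packed.z pk , Packed.Δ pk , Packed.Π pk , Packed.k pk
        κ : Ren (⟨ x ⟩ ⊕ ⟨ w (supp j) ⟩) (⟨ x ⟩ ⊕ restrict A S)
        κ = ⊕-ren (λ _ → id) (λ s i → ρ (supp j) s i , j , i , refl)
        same : ∀ b → (b & pull (ρ (supp j)) a) ≈[ κ ] (b & (a ↾ S))
        same b s (inj₁ _) = Dom.refl s
        same b s (inj₂ _) = Dom.refl s

-- From local character to rosiness

-- Plays the part of the cardinal |K|⁺: node f lies strictly above the whole family f,
-- so every set of at most |K| elements is bounded.

data Tree (K : Set) : Set where
  leaf : Tree K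
  node : (K → Tree K) → Tree K

module TreeOrder {K : Set} where

  infix 4 _≺_
  _≺_ : Tree K → Tree K → Set
  i ≺ leaf   = Empty.⊥
  i ≺ node f = ∃[ κ ] (i ≡ f κ ⊎ i ≺ f κ)

  ≺-trans : ∀ {i j} k → i ≺ j → j ≺ k → i ≺ k
  ≺-trans (node f) p (κ , inj₁ refl) = κ , inj₂ p
  ≺-trans (node f) p (κ , inj₂ q)    = κ , inj₂ (≺-trans (f κ) p q)

  ≺-irrefl : ∀ i → ¬ i ≺ i
  ≺-irrefl (node f) (κ , inj₁ e) = ≺-irrefl (f κ) (subst (f κ ≺_) e (κ , inj₁ refl))
  ≺-irrefl (node f) (κ , inj₂ p) = ≺-irrefl (f κ) (≺-trans (f κ) (κ , inj₁ refl) p)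

module Sorting (em : ∀ {ℓ} → ExcludedMiddle ℓ) {K : Set} where
  open TreeOrder {K}

  -- `≺` is only partial. All that is required is that the nodes below a given one are never treated
  -- after it.
  Sorted : List (Tree K) → Set
  Sorted = AllPairs (λ i j → i ≢ j × ¬ j ≺ i)

  insert : ∀ i l → Sorted l → ∃[ l′ ] Sorted l′ × i ∈ l′ × (∀ {j} → j ∈ l → j ∈ l′)
  insert i l sorted with em {P = i ∈ l}
  ... | yes i∈l = l , sorted , i∈l , id
  ... | no  i∉l = filter below? l ++ i ∷ filter above? l , sorted′ , ∈-++⁺ʳ (filter below? l) (here refl) , included
    where
    below? : ∀ j → Dec (j ≺ i)
    below? j = em
    above? : ∀ j → Dec (¬ j ≺ i)
    above? j = em
    i≢ : ∀ {j} → j ∈ l → i ≢ j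
    i≢ j∈l refl = i∉l j∈l
    sorted′ : Sorted (filter below? l ++ i ∷ filter above? l)
    sorted′ = AllPairs.++⁺ (AllPairs.filter⁺ below? sorted)
      (All.tabulate (λ j∈ → let j∈l , ¬j≺i = ∈-filter⁻ above? j∈ in i≢ j∈l , ¬j≺i) ∷ AllPairs.filter⁺ above? sorted)
      (All.tabulate λ {j} j∈ → let j∈l , j≺i = ∈-filter⁻ below? j∈ in
        (i≢ j∈l ∘ sym , λ i≺j → ≺-irrefl i (≺-trans i i≺j j≺i)) ∷
        All.tabulate λ k∈ → let k∈l , ¬k≺i = ∈-filter⁻ above? {xs = l} k∈ in
          (λ { refl → ¬k≺i j≺i }) , λ k≺j → ¬k≺i (≺-trans i k≺j j≺i))
    included : ∀ {j} → j ∈ l → j ∈ filter below? l ++ i ∷ filter above? l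
    included {j} j∈l with em {P = j ≺ i}
    ... | yes p = ∈-++⁺ˡ (∈-filter⁺ below? j∈l p)
    ... | no ¬p = ∈-++⁺ʳ (filter below? l) (there (∈-filter⁺ above? j∈l ¬p))

  sort : ∀ l → ∃[ l′ ] Sorted l′ × (∀ {j} → j ∈ l → j ∈ l′)
  sort [] = [] , [] , λ ()
  sort (i ∷ l) with sort l
  ... | l′ , sorted , incl with insert i l′ sorted
  ...   | l″ , sorted″ , i∈ , incl″ = l″ , sorted″ , λ { (here refl) → i∈ ; (there j∈) → incl″ (incl j∈) }

module Update (em : ∀ {ℓ} → ExcludedMiddle ℓ) {a b} {I : Set a} {A : Set b} where

  update : (I → A) → I → A → I → A
  update f i x j with em {P = i ≡ j}
  ... | yes _ = x
  ... | no _  = f j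

  update-same : ∀ f i x → update f i x i ≡ x
  update-same f i x with em {P = i ≡ i}
  ... | yes _ = refl
  ... | no n  = ⊥-elim (n refl)

  update-other : ∀ f i x j → i ≢ j → update f i x j ≡ f j
  update-other f i x j n with em {P = i ≡ j}
  ... | yes e = ⊥-elim (n e)
  ... | no _  = refl

-- Sets of unbounded rank

module Unbounded (em : ∀ {ℓ} → ExcludedMiddle ℓ) {L : Language} (N : Structure L)
                 {x y : List (Language.Sort L)} {z : Syntax.Ctx L} where
  open Thorn N
  open Classical em
  open Valuations N
  open Infinity em N
  open Ranks em N

  module _ (Δ : List (Formula (⟨ x ⟩ ⊕ ⟨ y ⟩))) (Π : List (Formula (⟨ y ⟩ ⊕ z))) (k : ℕ) where

    Unbounded : Pred (Tuple x) 1ℓ → Set₂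
    Unbounded X = ∀ α → R Δ Π k α X

    infix 4 _⊆_
    _⊆_ : Pred (Tuple x) 1ℓ → Pred (Tuple x) 1ℓ → Set₁
    X ⊆ Y = ∀ b → X b → Y b

    -- `avoid` expresses infinitude. `Infinite` does not apply, because `Unbounded` quantifies over
    -- ordinals and lives one universe higher than the predicates it accepts.
    record Step (δ : Formula (⟨ x ⟩ ⊕ ⟨ y ⟩)) (π : Formula (⟨ y ⟩ ⊕ z)) (X : Pred (Tuple x) 1ℓ) : Set₂ where
      constructor step
      field
        c            : Val z
        inconsistent : Inconsistent k δ (λ a → a & c ⊨ π)
        avoid        : ∀ F → Finite F → ∃[ a ] a & c ⊨ π × Unbounded (λ b → X b × b & a ⊨ δ) × ¬ F a

    -- A family for `sup`, whose index type must be inhabited: hence `nothing`. Where the rank is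
    -- undefined the value is immaterial.
    bound : Pred (Tuple x) 1ℓ → Maybe (Formula (⟨ x ⟩ ⊕ ⟨ y ⟩) × Tuple y) → Ordinal
    bound X nothing = zero
    bound X (just (δ , a)) with em {P = ∃[ α ] ¬ R Δ Π k α (λ b → X b × b & a ⊨ δ)}
    ... | yes (α , _) = α
    ... | no _        = zero

    bound⇒unbounded : ∀ {X δ a} → R Δ Π k (bound X (just (δ , a))) (λ b → X b × b & a ⊨ δ) → Unbounded (λ b → X b × b & a ⊨ δ)
    bound⇒unbounded {X} {δ} {a} r with em {P = ∃[ α ] ¬ R Δ Π k α (λ b → X b × b & a ⊨ δ)}
    ... | yes (α , n) = ⊥-elim (n r)
    ... | no n        = λ α → dne λ m → n (α , m)

    abstract

      -- A rank above all ranks of sets X ∧ δ(x , a) that are defined at all.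
      unbounded⇒step : ∀ {X} → Unbounded X → ∃[ δ ] ∃[ π ] δ ∈ Δ × π ∈ Π × Step δ π X
      unbounded⇒step {X} unb with unb (suc (sup (Maybe (Formula (⟨ x ⟩ ⊕ ⟨ y ⟩) × Tuple y)) nothing (bound X)))
      ... | δ , δ∈ , π , π∈ , c , inf , inc = δ , π , δ∈ , π∈ , step c inc λ F fin →
        let a , (p , r) , n = Infinite-∖ inf fin in a , p , bound⇒unbounded {X} {δ} {a} (r (just (δ , a))) , n

    -- Compactness requires one pair (δ , π) for the whole chain, so steps with other
    -- pairs are skipped by passing to smaller sets.
    Recurrent : Formula (⟨ x ⟩ ⊕ ⟨ y ⟩) × Formula (⟨ y ⟩ ⊕ z) → Pred (Tuple x) 1ℓ → Set₂
    Recurrent (δ , π) X = ∀ Y → Y ⊆ X → Unbounded Y → Σ[ Z ∈ Pred (Tuple x) 1ℓ ] Z ⊆ Y × Step δ π Z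

    abstract

      -- If q is not recurrent in X, some unbounded subset of X has no q-step in any of its subsets,
      -- and this persists when the next pair is excluded. Excluding all pairs of the rank would
      -- contradict `unbounded⇒step`.
      pigeonhole : ∀ qs X → Unbounded X →
                   (∃[ q ] Σ[ Y ∈ Pred (Tuple x) 1ℓ ] Unbounded Y × Recurrent q Y) ⊎
                   (Σ[ Y ∈ Pred (Tuple x) 1ℓ ] Y ⊆ X × Unbounded Y × (∀ {δ π} → (δ , π) ∈ qs → ∀ Z → Z ⊆ Y → ¬ Step δ π Z))
      pigeonhole [] X unb = inj₂ (X , (λ b → id) , unb , λ ())
      pigeonhole (q ∷ qs) X unb with em {P = Recurrent q X}
      ... | yes rec = inj₁ (q , X , unb , rec)
      ... | no n with ¬∀⇒∃¬ n
      ...   | Y , m with ¬→⇒×¬ m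
      ...     | Y⊆X , m′ with ¬→⇒×¬ m′
      ...       | unbY , none with pigeonhole qs Y unbY
      ...         | inj₁ found = inj₁ found
      ...         | inj₂ (Z , Z⊆Y , unbZ , noneZ) = inj₂ (Z , (λ b → Y⊆X b ∘ Z⊆Y b) , unbZ ,
                      λ { (here refl) W W⊆Z st → none (W , (λ b → Z⊆Y b ∘ W⊆Z b) , st) ; (there q∈) → noneZ q∈ })

      recurrent : ∀ {X} → Unbounded X → ∃[ q ] Σ[ Y ∈ Pred (Tuple x) 1ℓ ] Unbounded Y × Recurrent q Y
      recurrent {X} unb with pigeonhole (cartesianProduct Δ Π) X unb
      ... | inj₁ found = found
      ... | inj₂ (Y , _ , unbY , none) with unbounded⇒step unbY
      ...   | δ , π , δ∈ , π∈ , st = ⊥-elim (none (∈-cartesianProduct⁺ δ∈ π∈) Y (λ b → id) st)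

-- Þ-dividing chains indexed by trees

module LocalCharacterImpliesRosy (em : ∀ {ℓ} → ExcludedMiddle ℓ) {L : Language} (N : Structure L) (saturated : Saturated N)
                                 (K : Set) where
  open Thorn N
  open Classical em
  open Valuations N
  open Infinity em N
  open Definability em N
  open Compactness em N saturated
  open Ranks em N
  open Unbounded em N
  open TreeOrder {K}
  open Sorting em {K}
  open Update em

  module Chain {x y : List Sort} {z : Ctx} (k : ℕ) (δ : Formula (⟨ x ⟩ ⊕ ⟨ y ⟩)) (π : Formula (⟨ y ⟩ ⊕ z)) where

    Earlier : Tree K → Ctx
    Earlier i s = (Σ[ j ∈ Tree K ] j ≺ i) × s ∈ y

    past : (Tree K → Tuple y) → Val z → (i : Tree K) → Val (Earlier i ⊕ z)
    past f c i = (λ s ((j , _) , m) → f j s m) & c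

    Request : Set
    Request = Σ[ i ∈ Tree K ] Formula (⟨ y ⟩ ⊕ (Earlier i ⊕ z)) × ℕ

    -- Non-algebraicity of a over past f c i, for one formula and one bound at a time.
    Granted : (Tree K → Tuple y) → Val z → Tuple y → Request → Set₁
    Granted f c a (i , χ , m) = a & past f c i ⊨ χ → AtLeast m (λ a → a & past f c i ⊨ χ)

    InconsistentAt : Val z → Set₁
    InconsistentAt c = ∀ b → ¬ AtLeast k (λ a → a & c ⊨ π × b & a ⊨ δ)

    Holds : Tuple x → (Tree K → Tuple y) → (Tree K → Val z) → Request → Set₁
    Holds b f g r@(i , _) = b & f i ⊨ δ × f i & g i ⊨ π × InconsistentAt (g i) × Granted f (g i) (f i) r

    Granted-cong : ∀ {f f′ c a} r → (∀ j → j ≺ proj₁ r → f j ≡ f′ j) → Granted f c a r → Granted f′ c a r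
    Granted-cong {f} {f′} {c} {a} (i , χ , m) e h g =
      AtLeast-mono (λ a → ⊨-cong (same a) χ) (h (⊨-cong (≈-sym (same a)) χ g))
      where
      same : ∀ a → (a & past f c i) ≈ᵛ (a & past f′ c i)
      same a s (inj₁ _) = Dom.refl s
      same a s (inj₂ (inj₁ ((j , j≺i) , m))) rewrite e j j≺i = Dom.refl s
      same a s (inj₂ (inj₂ _)) = Dom.refl s

    module _ (f : Tree K → Tuple y) (c : Val z) where

      Bad : List Request → Tuple y → Set₁
      Bad rs a = Any (λ r → ¬ Granted f c a r) rs

      -- A request is refused only if its formula has finitely many solutions and the tuple is one
      -- of them. Hence `avoid` finds a tuple that grants finitely many requests at once.
      Finite-bad : ∀ rs → Finite (Bad rs)
      Finite-bad [] = [] , λ _ ()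
      Finite-bad (r@(i , χ , m) ∷ rs) = Finite-⊎ (λ a → Any.toSum) (one em) (Finite-bad rs)
        where
        one : Dec (Finite (λ a → a & past f c i ⊨ χ)) → Finite (λ a → ¬ Granted f c a r)
        one (yes fin) = Finite-mono (λ a n → proj₁ (¬→⇒×¬ n)) fin
        one (no inf)  = [] , λ a n → ⊥-elim (n λ _ → Infinite⇒AtLeast inf m)

    module _ (Δ : List (Formula (⟨ x ⟩ ⊕ ⟨ y ⟩))) (Π : List (Formula (⟨ y ⟩ ⊕ z))) {X : Pred (Tuple x) 1ℓ}
             (recurs : Recurrent Δ Π k (δ , π) X) (rs : List Request) where

      Built : List (Tree K) → Pred (Tuple x) 1ℓ → (Tree K → Tuple y) → (Tree K → Val z) → Set₁
      Built l Y f g = Σ[ f′ ∈ (Tree K → Tuple y) ] Σ[ g′ ∈ (Tree K → Val z) ]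
        (∀ j → ¬ j ∈ l → f′ j ≡ f j × g′ j ≡ g j) ×
        ∃[ b ] Y b × (∀ {i} → i ∈ l → All (λ r → i ≡ proj₁ r → Holds b f′ g′ r) rs)

      -- The set shrinks by δ(x , a) at each node and b is picked from the last set, so it satisfies
      -- all these formulas. What is granted at i stays granted, because it depends on `f` only
      -- below i and no such value changes later.
      build : ∀ l → Sorted l → ∀ Y → _⊆_ Δ Π k Y X → Unbounded Δ Π k Y → ∀ f g → Built l Y f g
      build [] [] Y Y⊆X unb f g = let b , h = unb zero in f , g , (λ j _ → refl , refl) , b , h , λ ()
      build (i ∷ l) (later ∷ sorted) Y Y⊆X unb f g with recurs Y Y⊆X unb
      ... | Z , Z⊆Y , step c inc avoid with avoid (Bad f c rs) (Finite-bad f c rs)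
      ...   | a , p , unbZ , good with
                build l sorted (λ b → Z b × b & a ⊨ δ) (λ b (h , _) → Y⊆X b (Z⊆Y b h)) unbZ (update f i a) (update g i c)
      ...     | f′ , g′ , fixed , b , (Zb , b⊨δ) , holds = f′ , g′ , fixed′ , b , Z⊆Y b Zb , holds′
        where
        fixed′ : ∀ j → ¬ j ∈ i ∷ l → f′ j ≡ f j × g′ j ≡ g j
        fixed′ j j∉ with fixed j (j∉ ∘ there)
        ... | e , e′ = trans e (update-other f i a j λ { refl → j∉ (here refl) }) ,
                       trans e′ (update-other g i c j λ { refl → j∉ (here refl) })
        i∉l : ¬ i ∈ l
        i∉l i∈l = proj₁ (All.lookup later i∈l) refl
        f′i : f′ i ≡ a
        f′i = trans (proj₁ (fixed i i∉l)) (update-same f i a)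
        g′i : g′ i ≡ c
        g′i = trans (proj₂ (fixed i i∉l)) (update-same g i c)
        earlier : ∀ j → j ≺ i → f j ≡ f′ j
        earlier j j≺i = sym (trans (proj₁ (fixed j λ j∈l → proj₂ (All.lookup later j∈l) j≺i))
                                   (update-other f i a j λ { refl → ≺-irrefl i j≺i }))
        holds-here : ∀ r → Granted f c a r → i ≡ proj₁ r → Holds b f′ g′ r
        holds-here r gr refl rewrite f′i | g′i =
          b⊨δ , p , Inconsistent⇒¬AtLeast {δ = δ} {P = λ a → a & c ⊨ π} inc , Granted-cong r earlier gr
        holds′ : ∀ {j} → j ∈ i ∷ l → All (λ r → j ≡ proj₁ r → Holds b f′ g′ r) rs
        holds′ (here refl) = All.tabulate λ {r} r∈ → holds-here r (dne λ n → good (Any.map (λ { refl → n }) r∈))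
        holds′ (there j∈l) = holds j∈l

    Vars : Ctx
    Vars s = s ∈ x ⊎ ((Tree K × s ∈ y) ⊎ (Tree K × z s))

    point : Val Vars → Tuple x
    point v s m = v s (inj₁ m)

    tuple : Val Vars → Tree K → Tuple y
    tuple v i s m = v s (inj₂ (inj₁ (i , m)))

    param : Val Vars → Tree K → Val z
    param v i s n = v s (inj₂ (inj₂ (i , n)))

    abstract

      definable-holds : ∀ r → Definable (λ v → Holds (point v) (tuple v) (param v) r)
      definable-holds (i , χ , m) =
        def-× (def-⊨ δ (λ _ → inj₁) at-tuple)
        (def-× (def-⊨ π at-tuple at-param)
        (def-× (def-∀ {D = λ v → ¬ AtLeast k (λ a → a & param (fst v) i ⊨ π × snd v & a ⊨ δ)}
                 (def-¬ (def-AtLeast k {P = λ v a → a & param (fst v) i ⊨ π × snd v & a ⊨ δ}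
                   (def-× (def-⊨ π (λ _ → inj₂) (λ s → inj₁ ∘ inj₁ ∘ at-param s)) (def-⊨ δ (λ _ → inj₁ ∘ inj₂) (λ _ → inj₂))))))
          (def-→ (def-formula {E = λ v → tuple v i & past (tuple v) (param v i) i} χ
                    (λ s → [ at-tuple s , at-past s ])
                     λ v → λ { s (inj₁ _) → Dom.refl s ; s (inj₂ (inj₁ _)) → Dom.refl s ; s (inj₂ (inj₂ _)) → Dom.refl s })
                 (def-AtLeast m {P = λ v a → a & past (tuple v) (param v i) i ⊨ χ}
                   (def-formula {E = λ v → snd v & past (tuple (fst v)) (param (fst v) i) i} χ
                     (λ s → [ inj₂ , inj₁ ∘ at-past s ])
                     λ v → λ { s (inj₁ _) → Dom.refl s ; s (inj₂ (inj₁ _)) → Dom.refl s ; s (inj₂ (inj₂ _)) → Dom.refl s })))))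
        where
        at-tuple : Ren ⟨ y ⟩ Vars
        at-tuple s m = inj₂ (inj₁ (i , m))
        at-param : Ren z Vars
        at-param s n = inj₂ (inj₂ (i , n))
        at-past : Ren (Earlier i ⊕ z) Vars
        at-past s (inj₁ ((j , _) , m)) = inj₂ (inj₁ (j , m))
        at-past s (inj₂ n)             = inj₂ (inj₂ (i , n))

      chain : ∀ Δ Π {X} → Unbounded Δ Π k X → Recurrent Δ Π k (δ , π) X →
              ∃[ v ] ∀ r → Holds (point v) (tuple v) (param v) r
      chain Δ Π {X} unb recurs = compactness definable-holds sat
        where
        sat : ∀ rs → ∃[ v ] All (Holds (point v) (tuple v) (param v)) rs
        -- This first step only provides default values for `f` and `g`, as a sort might be empty.
        sat rs with recurs X (λ b → id) unb
        ... | _ , _ , step c _ avoid with avoid (λ _ → Level.Lift 1ℓ Empty.⊥) ([] , λ { _ () })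
        ...   | a , _ with sort (map proj₁ rs)
        ...     | l , sorted , incl with build Δ Π recurs rs l sorted X (λ b → id) unb (λ _ → a) (λ _ → c)
        ...       | f , g , _ , b , _ , holds = v , All.tabulate λ {r} r∈ → All.lookup (holds (incl (∈-map⁺ proj₁ r∈))) r∈ refl
          where
          v : Val Vars
          v s (inj₁ m)              = b s m
          v s (inj₂ (inj₁ (i , m))) = f i s m
          v s (inj₂ (inj₂ (i , n))) = g i s n

    -- The auxiliary tuple of þ-dividing is the whole past of i together with `g i`; the parameters
    -- e merely repeat a part of it, and `κ` identifies the copies.
    thorn-divides : ∀ {b f g} → (∀ r → Holds b f g r) → ∀ {A : Ctx} (e : Val A) i (ρ : Ren A (Earlier i)) →
                    e ≈[ ρ ] (λ s ((j , _) , m) → f j s m) → ThornDivides δ (f i) e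
    thorn-divides {b} {f} {g} holds {A} e i ρ same = Earlier i ⊕ z , past f (g i) i , nonalgebraic , k , inconsistent
      where
      κ : Ren (⟨ y ⟩ ⊕ (A ⊕ (Earlier i ⊕ z))) (⟨ y ⟩ ⊕ (Earlier i ⊕ z))
      κ s = [ inj₁ , inj₂ ∘ [ inj₁ ∘ ρ s , id ] ]
      same′ : ∀ a → (a & (e & past f (g i) i)) ≈[ κ ] (a & past f (g i) i)
      same′ a s (inj₁ _)        = Dom.refl s
      same′ a s (inj₂ (inj₁ v)) = same s v
      same′ a s (inj₂ (inj₂ _)) = Dom.refl s
      nonalgebraic : ¬ Algebraic (tp (f i) (e & past f (g i) i)) (e & past f (g i) i)
      nonalgebraic (χ , h , fin) = ¬Finite (λ m → AtLeast-mono (λ a → ⊨-ren⁻ {b = a & past f (g i) i} κ (same′ a) χ)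
        (proj₂ (proj₂ (proj₂ (holds (i , ren κ χ , m)))) (⊨-ren⁺ {b = f i & past f (g i) i} κ (same′ (f i)) χ h))) fin
      τ : Ren (⟨ y ⟩ ⊕ z) (⟨ y ⟩ ⊕ (A ⊕ (Earlier i ⊕ z)))
      τ s = [ inj₁ , inj₂ ∘ inj₂ ∘ inj₂ ]
      sameτ : ∀ a → (a & g i) ≈[ τ ] (a & (e & past f (g i) i))
      sameτ a s (inj₁ _) = Dom.refl s
      sameτ a s (inj₂ _) = Dom.refl s
      inconsistent : Inconsistent k δ (Realizes (tp (f i) (e & past f (g i) i)) (e & past f (g i) i))
      inconsistent with holds (i , ⊤ᶠ , 0)
      ... | _ , h , inc , _ = Inconsistent-mono {δ = δ} {P = λ a → a & g i ⊨ π}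
        {Q = Realizes (tp (f i) (e & past f (g i) i)) (e & past f (g i) i)}
        (λ a r → ⊨-ren⁻ {b = a & (e & past f (g i) i)} τ (sameτ a) π
          (r (ren τ π) (⊨-ren⁺ {b = f i & (e & past f (g i) i)} τ (sameτ (f i)) π h)))
        (¬AtLeast⇒Inconsistent {δ = δ} {P = λ a → a & g i ⊨ π} inc)

    no-chain : ThornLocalCharacter K → ∀ {b f g} → ¬ (∀ r → Holds b f g r)
    no-chain lc {b} {f} {g} holds = ¬forks forks
      where
      A : Ctx
      A s = Tree K × s ∈ y
      a : Val A
      a s (i , m) = f i s m
      p : Partial ⟨ x ⟩ A
      p = tp b a
      ct : CompleteType p a
      ct = record { consistent = λ φs hs → b , hs ; complete = complete }
        where
        complete : ∀ φ → p φ ⊎ p (~ φ)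
        complete φ with em {P = p φ}
        ... | yes h = inj₁ h
        ... | no n  = inj₂ (Level.lift ∘ n)
      S : Subset A
      S = proj₁ (lc a p ct)
      to : (Σ Sort (restrict A S)) ↣ K
      to = proj₁ (proj₂ (lc a p ct))
      ¬forks : ¬ TypeThornForks p a (a ↾ S)
      ¬forks = proj₂ (proj₂ (lc a p ct))
      index : Σ Sort (restrict A S) → Tree K
      index (s , (i , m) , _) = i
      -- A `K`-indexed family that meets the index of every parameter in `S`, with `leaf` as filler;
      -- `node h` then lies above all of them.
      h : K → Tree K
      h κ with em {P = ∃[ v ] Injection.to to v ≡ κ}
      ... | yes (v , _) = index v
      ... | no _        = leaf
      h-to : ∀ v → index v ≡ h (Injection.to to v)
      h-to v with em {P = ∃[ u ] Injection.to to u ≡ Injection.to to v}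
      ... | yes (u , e) = cong index (sym (Injection.injective to e))
      ... | no n        = ⊥-elim (n (v , refl))
      i : Tree K
      i = node h
      ρ : Ren (restrict A S) (Earlier i)
      ρ s v@((j , m) , _) = (j , Injection.to to (s , v) , inj₁ (h-to (s , v))) , m
      forks : TypeThornForks p a (a ↾ S)
      forks = ⟨ y ⟩ , δ , f i ,
              (λ c r → ⊨-ren⁻ {b = c & a} κ (same c) δ (r (ren κ δ) (⊨-ren⁺ {b = b & a} κ (same b) δ (proj₁ (holds (i , ⊤ᶠ , 0)))))) ,
              inst δ (f i) ∷ [] , thorn-divides {b} {f} {g} holds (a ↾ S) i ρ (λ s v → Dom.refl s) ∷ [] , λ c h → here h
        where
        κ : Ren (⟨ x ⟩ ⊕ ⟨ y ⟩) (⟨ x ⟩ ⊕ A)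
        κ = ⊕-ren (λ _ → id) (λ s m → i , m)
        same : ∀ c → (c & f i) ≈[ κ ] (c & a)
        same c s (inj₁ _) = Dom.refl s
        same c s (inj₂ _) = Dom.refl s

  ranksDefined : ThornLocalCharacter K → RanksDefined
  ranksDefined lc {x} {y} {z} {P} Δ Π k φ e = dne λ n →
    let (δ , π) , Y , unb , rec = recurrent Δ Π k (λ α → rank⇒R Δ Π k α φ e (dne λ m → n (α , m)))
        v , holds = Chain.chain k δ π Δ Π unb rec
    in Chain.no-chain k δ π lc holds

-- Saturation of imaginaries

module Imaginaries (em : ∀ {ℓ} → ExcludedMiddle ℓ) {L : Language} {T : Theory L} (complete : Complete L T)
                   (M : Structure L) (M⊨T : Semantics.Models M T) where

  N : Structure (language^eq L T)
  N = structure^eq complete M M⊨T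

  open Thorn M
  open Classical em
  open Valuations M
  open Definability em M
  module S^eq = Syntax (language^eq L T)
  module N = Thorn N
  module Nᵛ = Valuations N

  def-≈-terms : ∀ {Γ : Ctx} {w} (ts : All (Term Γ) w) → Definable {Γ ⊕ ⟨ w ⟩} (λ v → snd v ≈ᵛ evals (fst v) ts)
  def-≈-terms [] = def-true λ _ _ ()
  def-≈-terms {Γ} {s ∷ w} (t ∷ ts) =
    def-⇔ (λ v (h , hs) → λ { _ (here refl) → Dom.trans s h (Dom.sym s (eval-ren (λ _ → inj₁) (λ s v → Dom.refl s) t))
                            ; s (there i)   → hs s i })
          (λ v h → Dom.trans s (h s (here refl)) (eval-ren (λ _ → inj₁) (λ s v → Dom.refl s) t) , λ s i → h s (there i))
          (def-× head (def-pull (λ s → [ inj₁ , inj₂ ∘ there ]) (def-≈-terms ts)))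
    where
    head : Definable {Γ ⊕ ⟨ s ∷ w ⟩} (λ v → v ⊨ (var (inj₂ (here refl)) ≐ renᵗ (λ _ → inj₁) t))
    head = def-formula {E = id} (var (inj₂ (here refl)) ≐ renᵗ (λ _ → inj₁) t) (λ _ → id) λ v s _ → Dom.refl s

  -- A variable of a quotient sort w / E is represented by a w-tuple of home variables.
  Rep : Ctx → EqSort L T → Set
  Rep Δ (home s)     = Δ s
  Rep Δ (quot w E e) = Ren ⟨ w ⟩ Δ

  Env : S^eq.Ctx → Ctx → Set
  Env Γ Δ = ∀ t → Γ t → Rep Δ t

  value : ∀ {Δ : Ctx} t → Rep Δ t → Val Δ → N.Dom.Carrier t
  value (home s)     v d = d s v
  value (quot w E e) ρ d = pull ρ d

  assemble : ∀ {Γ} {Δ : Ctx} → Env Γ Δ → Val Δ → N.Val Γ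
  assemble ρ d t v = value t (ρ t v) d

  RepTerm : Ctx → EqSort L T → Set
  RepTerm Δ (home s)     = Term Δ s
  RepTerm Δ (quot w E e) = All (Term Δ) w

  -- At quotient sorts this is coordinatewise agreement, finer than equality of classes, so that
  -- representatives may be exchanged inside any formula of the home sorts.
  Evaluates : ∀ {Δ : Ctx} → Val Δ → ∀ t → RepTerm Δ t → N.Dom.Carrier t → Set₁
  Evaluates d (home s)     u x = Dom._≈_ s (eval d u) x
  Evaluates d (quot w E e) u x = evals d u ≈ᵛ x

  variables : ∀ {Δ : Ctx} w → Ren ⟨ w ⟩ Δ → All (Term Δ) w
  variables []      ρ = []
  variables (s ∷ w) ρ = var (ρ s (here refl)) ∷ variables w (λ t → ρ t ∘ there)

  evals-variables : ∀ {Δ : Ctx} w (ρ : Ren ⟨ w ⟩ Δ) (d : Val Δ) → evals d (variables w ρ) ≈ᵛ pull ρ d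
  evals-variables (s ∷ w) ρ d _ (here refl) = Dom.refl s
  evals-variables (s ∷ w) ρ d t (there i)   = evals-variables w (λ t → ρ t ∘ there) d t i

  module _ {Γ : S^eq.Ctx} {Δ : Ctx} (ρ : Env Γ Δ) where

    mutual
      term : ∀ {t} → S^eq.Term Γ t → RepTerm Δ t
      term (S^eq.var {home s} v)        = var (ρ _ v)
      term (S^eq.var {quot w E e} v)    = variables w (ρ _ v)
      term (S^eq.app (base f) ts)       = app f (terms _ ts)
      term (S^eq.app (proj w E e) ts)   = terms w ts

      terms : ∀ w → All (S^eq.Term Γ) (map home w) → All (Term Δ) w
      terms []      []       = []
      terms (s ∷ w) (t ∷ ts) = term t ∷ terms w ts

    module _ (d : Val Δ) where

      mutual
        term-evaluates : ∀ {t} (u : S^eq.Term Γ t) → Evaluates d t (term u) (N.eval (assemble ρ d) u)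
        term-evaluates (S^eq.var {home s} v)      = Dom.refl s
        term-evaluates (S^eq.var {quot w E e} v)  = evals-variables w (ρ _ v) d
        term-evaluates (S^eq.app (base f) ts)     = ⟦ f ⟧ᶠ-cong (terms-evaluate _ ts)
        term-evaluates (S^eq.app (proj w E e) ts) = terms-evaluate w ts

        terms-evaluate : ∀ w (ts : All (S^eq.Term Γ) (map home w)) →
                         evals d (terms w ts) ≈ᵛ (λ s i → N.evals (assemble ρ d) ts (home s) (∈-map⁺ home i))
        terms-evaluate (s ∷ w) (t ∷ ts) _ (here refl) = term-evaluates t
        terms-evaluate (s ∷ w) (t ∷ ts) u (there i)   = terms-evaluate w ts u i

  weaken : ∀ {Δ : Ctx} {w} t → Rep Δ t → Rep (Δ ⊕ ⟨ w ⟩) t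
  weaken (home s)     v = inj₁ v
  weaken (quot w E e) ρ = λ s → inj₁ ∘ ρ s

  sorts : EqSort L T → List (Language.Sort L)
  sorts (home s)     = s ∷ []
  sorts (quot w E e) = w

  new : ∀ {Δ : Ctx} t → Rep (Δ ⊕ ⟨ sorts t ⟩) t
  new (home s)     = inj₂ (here refl)
  new (quot w E e) = λ s → inj₂

  extend : ∀ {Γ} {Δ : Ctx} t → Env Γ Δ → Env (Γ S^eq.▹ t) (Δ ⊕ ⟨ sorts t ⟩)
  extend t ρ u (inj₁ v)    = weaken u (ρ u v)
  extend t ρ u (inj₂ refl) = new t

  element : ∀ t → Tuple (sorts t) → N.Dom.Carrier t
  element (home s)     b = b s (here refl)
  element (quot w E e) b = b

  coordinates : ∀ t → N.Dom.Carrier t → Tuple (sorts t)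
  coordinates (home s)     x _ (here refl) = x
  coordinates (quot w E e) x = x

  element-coordinates : ∀ t x → N.Dom._≈_ t (element t (coordinates t x)) x
  element-coordinates (home s)     x = Dom.refl s
  element-coordinates (quot w E e) x = N.Dom.refl (quot w E e)

  assemble-extend : ∀ {Γ} {Δ : Ctx} t (ρ : Env Γ Δ) d b x → N.Dom._≈_ t (element t b) x →
                    assemble (extend t ρ) (d & b) N.≈ᵛ (assemble ρ d N.& N.single x)
  assemble-extend t ρ d b x e (home s)     (inj₁ v)    = Dom.refl s
  assemble-extend t ρ d b x e (quot w E q) (inj₁ v)    = N.Dom.refl (quot w E q)
  assemble-extend (home s)     ρ d b x e _ (inj₂ refl) = e
  assemble-extend (quot w E q) ρ d b x e _ (inj₂ refl) = e

  definable-eq : ∀ {Γ} {Δ : Ctx} (ρ : Env Γ Δ) t (u v : S^eq.Term Γ t) →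
                 Definable (λ d → N.Dom._≈_ t (N.eval (assemble ρ d) u) (N.eval (assemble ρ d) v))
  definable-eq ρ (home s) u v =
    def-⇔ (λ d h → Dom.trans s (Dom.sym s (term-evaluates ρ d u)) (Dom.trans s h (term-evaluates ρ d v)))
          (λ d h → Dom.trans s (term-evaluates ρ d u) (Dom.trans s h (Dom.sym s (term-evaluates ρ d v))))
          (def-formula {E = id} (term ρ u ≐ term ρ v) (λ _ → id) λ v s _ → Dom.refl s)
  -- The terms enter `E` through quantified tuples equal to their values, so that renaming variables
  -- suffices.
  definable-eq {Δ = Δ} ρ (quot w E e) u v =
    def-⇔ (λ d (a , a≈ , b , b≈ , h) → ⊨-cong (&-≈ (≈-trans a≈ (term-evaluates ρ d u)) (≈-trans b≈ (term-evaluates ρ d v))) E h)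
          (λ d h → _ , ≈-refl , _ , ≈-refl , ⊨-cong (&-≈ (≈-sym (term-evaluates ρ d u)) (≈-sym (term-evaluates ρ d v))) E h)
          (def-∃ {D = λ c → snd c ≈ᵛ evals (fst c) (term ρ u) × ∃[ b ] b ≈ᵛ evals (fst c) (term ρ v) × snd c & b ⊨ E}
            (def-× (def-≈-terms (term ρ u))
              (def-∃ {D = λ c → snd c ≈ᵛ evals (fst (fst c)) (term ρ v) × snd (fst c) & snd c ⊨ E}
                (def-× (def-pull (λ s → [ inj₁ ∘ inj₁ , inj₂ ]) (def-≈-terms (term ρ v)))
                       (def-⊨ E (λ _ → inj₁ ∘ inj₂) (λ _ → inj₂))))))

  -- A quantifier over classes becomes one over representatives: every tuple represents a class, and
  -- truth is invariant under the equality of the quotient.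
  definable-truth : ∀ {Γ} {Δ : Ctx} (ρ : Env Γ Δ) (φ : S^eq.Formula Γ) → Definable (λ d → assemble ρ d N.⊨ φ)
  definable-truth ρ S^eq.⊥ᶠ = definable empty ⊥ᶠ (λ _ → id) (λ _ → id)
  definable-truth ρ (u S^eq.≐ v) = definable-eq ρ _ u v
  definable-truth ρ (S^eq.rel (base r) ts) =
    def-⇔ (λ d → ⟦ r ⟧ʳ-cong (terms-evaluate ρ d _ ts)) (λ d → ⟦ r ⟧ʳ-cong (≈-sym (terms-evaluate ρ d _ ts)))
    (def-formula {E = id} (rel r (terms ρ _ ts)) (λ _ → id) λ v s _ → Dom.refl s)
  definable-truth ρ (φ S^eq.∧ ψ) = def-× (definable-truth ρ φ) (definable-truth ρ ψ)
  definable-truth ρ (φ S^eq.⇒ ψ) = def-→ (definable-truth ρ φ) (definable-truth ρ ψ)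
  definable-truth ρ (S^eq.all t φ) =
    def-⇔ (λ d h x → Nᵛ.⊨-cong (assemble-extend t ρ d _ x (element-coordinates t x)) φ (h (coordinates t x)))
          (λ d h b → Nᵛ.⊨-cong (Nᵛ.≈-sym (assemble-extend t ρ d b (element t b) (N.Dom.refl t))) φ (h (element t b)))
          (def-∀ (definable-truth (extend t ρ) φ))

  data Homes (Γ : S^eq.Ctx) (s : Sort) : Set where
    home : Γ (home s) → Homes Γ s
    quot : ∀ {w E} .{e} → Γ (quot w E e) → s ∈ w → Homes Γ s

  homes : ∀ {Γ Δ} → S^eq.Ren Γ Δ → Env Γ (Homes Δ)
  homes ρ (home s)     v = home (ρ _ v)
  homes ρ (quot w E e) v = λ s i → quot (ρ _ v) i

  disassemble : ∀ {Γ} → N.Val Γ → Val (Homes Γ)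
  disassemble b s (home v)   = b _ v
  disassemble b s (quot v i) = b _ v s i

  assemble-disassemble : ∀ {Γ} (b : N.Val Γ) → assemble (homes (λ _ → id)) (disassemble b) N.≈ᵛ b
  assemble-disassemble b (home s)     v = Dom.refl s
  assemble-disassemble b (quot w E e) v = N.Dom.refl (quot w E e)

  both : ∀ {Γ Δ} → Env (Γ S^eq.⊕ Δ) (Homes Γ ⊕ Homes Δ)
  both (home s)     (inj₁ v) = inj₁ (home v)
  both (home s)     (inj₂ v) = inj₂ (home v)
  both (quot w E e) (inj₁ v) = λ s i → inj₁ (quot v i)
  both (quot w E e) (inj₂ v) = λ s i → inj₂ (quot v i)

  assemble-both : ∀ {Γ Δ} (d : Val (Homes Γ)) (a : N.Val Δ) →
                  assemble both (d & disassemble a) N.≈ᵛ (assemble (homes (λ _ → id)) d N.& a)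
  assemble-both d a (home s)     (inj₁ v) = Dom.refl s
  assemble-both d a (home s)     (inj₂ v) = Dom.refl s
  assemble-both d a (quot w E e) (inj₁ v) = N.Dom.refl (quot w E e)
  assemble-both d a (quot w E e) (inj₂ v) = N.Dom.refl (quot w E e)

  abstract

    saturated^eq : Saturated M → Saturated N
    saturated^eq saturated {Γ} {A} a p fs =
      let d , h = compactness def sat in asm d , h
      where
      open Compactness em M saturated
      asm : Val (Homes Γ) → N.Val Γ
      asm = assemble (homes (λ _ → id))
      D : S^eq.Formula (Γ S^eq.⊕ A) → Val (Homes Γ) → Set₁
      D φ d = p φ → asm d N.& a N.⊨ φ
      def : ∀ φ → Definable (D φ)
      def φ = def-→ (def-const (p φ)) (def-⇔ (λ d → Nᵛ.⊨-cong (assemble-both d a) φ)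
                                             (λ d → Nᵛ.⊨-cong (Nᵛ.≈-sym (assemble-both d a)) φ)
                (def-param (disassemble a) (definable-truth both φ)))
      sat : ∀ φs → ∃[ d ] All (λ φ → D φ d) φs
      sat φs with select p φs
      ... | ψs , ps , implies with fs ψs ps
      ...   | b , hs = disassemble b , implies (All.map (λ {φ} → Nᵛ.⊨-cong (Nᵛ.≈-sym (Nᵛ.&-≈ (assemble-disassemble b) Nᵛ.≈-refl)) φ) hs)

-- Cardinality of the set of formulas with imaginaries

-- Finite binary trees absorb pairs, sums and lists without any cardinal arithmetic.
data Code (X : Set) : Set where
  nil  : Code X
  atom : X → Code X
  node : Code X → Code X → Code X

module Coding {X : Set} where
  open Injection using (to; injective)

  nodeˡ : ∀ {a b c d : Code X} → node a b ≡ node c d → a ≡ c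
  nodeˡ refl = refl

  nodeʳ : ∀ {a b c d : Code X} → node a b ≡ node c d → b ≡ d
  nodeʳ refl = refl

  code-Σ : {A : Set} {B : A → Set} → A ↣ Code X → (∀ a → B a ↣ Code X) → Σ A B ↣ Code X
  code-Σ {A} {B} f g = mk↣ {to = λ (a , b) → node (to f a) (to (g a) b)} inj
    where
    inj : ∀ {u v : Σ A B} → node (to f (proj₁ u)) (to (g (proj₁ u)) (proj₂ u)) ≡
                            node (to f (proj₁ v)) (to (g (proj₁ v)) (proj₂ v)) → u ≡ v
    inj {a , b} {c , d} e with injective f (nodeˡ e)
    ... | refl = cong (a ,_) (injective (g a) (nodeʳ e))

  code-⊎ : {A B : Set} → A ↣ Code X → B ↣ Code X → (A ⊎ B) ↣ Code X
  code-⊎ {A} {B} f g = mk↣ {to = h} inj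
    where
    h : A ⊎ B → Code X
    h (inj₁ a) = node nil (to f a)
    h (inj₂ b) = node (node nil nil) (to g b)
    inj : ∀ {u v} → h u ≡ h v → u ≡ v
    inj {inj₁ a} {inj₁ b} e = cong inj₁ (injective f (nodeʳ e))
    inj {inj₂ a} {inj₂ b} e = cong inj₂ (injective g (nodeʳ e))
    inj {inj₁ a} {inj₂ b} ()
    inj {inj₂ a} {inj₁ b} ()

  code-List : {A : Set} → A ↣ Code X → List A ↣ Code X
  code-List {A} f = mk↣ {to = h} inj
    where
    h : List A → Code X
    h []       = nil
    h (a ∷ as) = node (to f a) (h as)
    inj : ∀ {u v} → h u ≡ h v → u ≡ v
    inj {[]}     {[]}     e = refl
    inj {a ∷ as} {b ∷ bs} e with injective f (nodeˡ e) | inj {as} {bs} (nodeʳ e)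
    ... | refl | refl = refl
    inj {[]}     {_ ∷ _}  ()
    inj {_ ∷ _}  {[]}     ()

  code-ℕ : ℕ ↣ Code X
  code-ℕ = mk↣ {to = h} inj
    where
    h : ℕ → Code X
    h zero    = nil
    h (suc n) = node nil (h n)
    inj : ∀ {m n} → h m ≡ h n → m ≡ n
    inj {zero}  {zero}  e = refl
    inj {suc m} {suc n} e = cong suc (inj (nodeʳ e))
    inj {zero}  {suc n} ()
    inj {suc m} {zero}  ()

  -- A position determines the entry found there, so only the position is coded.
  code-∈ : {A : Set} (w : List A) → (Σ[ s ∈ A ] s ∈ w) ↣ Code X
  code-∈ {A} w = mk↣ {to = λ (s , i) → h i} inj
    where
    h : ∀ {w : List A} {s} → s ∈ w → Code X
    h (here _)  = nil
    h (there i) = node nil (h i)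
    inj : ∀ {w : List A} {u v : Σ[ s ∈ A ] s ∈ w} → h (proj₂ u) ≡ h (proj₂ v) → u ≡ v
    inj {u = _ , here refl} {_ , here refl} e = refl
    inj {u = _ , there i}   {_ , there j}   e with inj {u = _ , i} {_ , j} (nodeʳ e)
    ... | refl = refl
    inj {u = _ , here _}    {_ , there _}   ()
    inj {u = _ , there _}   {_ , here _}    ()

module FormulaCoding {X : Set} (L : Language)
                     (sort : Language.Sort L ↣ Code X)
                     (fun  : (Σ[ w ∈ List (Language.Sort L) ] Σ[ s ∈ Language.Sort L ] Language.Fun L w s) ↣ Code X)
                     (rel′ : (Σ[ w ∈ List (Language.Sort L) ] Language.Rel L w) ↣ Code X) where
  open Syntax L
  open Coding {X}
  open Injection using (to; injective)

  Variables : Ctx → Set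
  Variables Γ = Σ Sort Γ

  code-⊕ : ∀ {Γ Δ : Ctx} → Variables Γ ↣ Code X → Variables Δ ↣ Code X → Variables (Γ ⊕ Δ) ↣ Code X
  code-⊕ {Γ} {Δ} f g = mk↣ {to = λ v → to (code-⊎ f g) (h v)} (inj ∘ injective (code-⊎ f g))
    where
    h : Variables (Γ ⊕ Δ) → Variables Γ ⊎ Variables Δ
    h (s , inj₁ v) = inj₁ (s , v)
    h (s , inj₂ v) = inj₂ (s , v)
    inj : ∀ {u v} → h u ≡ h v → u ≡ v
    inj {_ , inj₁ _} {_ , inj₁ _} refl = refl
    inj {_ , inj₂ _} {_ , inj₂ _} refl = refl
    inj {_ , inj₁ _} {_ , inj₂ _} ()
    inj {_ , inj₂ _} {_ , inj₁ _} ()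

  code-▹ : ∀ {Γ : Ctx} {s} → Variables Γ ↣ Code X → Variables (Γ ▹ s) ↣ Code X
  code-▹ f = code-⊕ f (mk↣ {to = λ _ → nil} λ { {_ , refl} {_ , refl} _ → refl })

  -- Coding is given as a relation, so that injectivity becomes functionality and
  -- pairs of different constructors need not be treated.
  mutual
    data CodesTerm {Γ : Ctx} (ev : Variables Γ ↣ Code X) : Code X → ∀ {s} → Term Γ s → Set where
      var : ∀ {c s} {v : Γ s} → c ≡ to ev (s , v) → CodesTerm ev (node nil c) (var v)
      app : ∀ {c d w s} {f : Fun w s} {ts} → c ≡ to fun (w , s , f) → CodesTerms ev d ts →
            CodesTerm ev (node (node c nil) d) (app f ts)

    data CodesTerms {Γ : Ctx} (ev : Variables Γ ↣ Code X) : Code X → ∀ {w} → All (Term Γ) w → Set where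
      []  : CodesTerms ev nil []
      _∷_ : ∀ {c d s w} {t : Term Γ s} {ts : All (Term Γ) w} → CodesTerm ev c t → CodesTerms ev d ts →
            CodesTerms ev (node c d) (t ∷ ts)

  data CodesFormula {Γ : Ctx} (ev : Variables Γ ↣ Code X) : Code X → Formula Γ → Set where
    ⊥ᶠ  : CodesFormula ev nil ⊥ᶠ
    _≐_ : ∀ {c d s} {t u : Term Γ s} → CodesTerm ev c t → CodesTerm ev d u → CodesFormula ev (node nil (node c d)) (t ≐ u)
    rel : ∀ {c d w} {r : Rel w} {ts} → c ≡ to rel′ (w , r) → CodesTerms ev d ts →
          CodesFormula ev (node (node nil nil) (node c d)) (rel r ts)
    _∧_ : ∀ {c d φ ψ} → CodesFormula ev c φ → CodesFormula ev d ψ →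
          CodesFormula ev (node (node nil (node nil nil)) (node c d)) (φ ∧ ψ)
    _⇒_ : ∀ {c d φ ψ} → CodesFormula ev c φ → CodesFormula ev d ψ →
          CodesFormula ev (node (node (node nil nil) nil) (node c d)) (φ ⇒ ψ)
    all : ∀ {c d s φ} → c ≡ to sort s → CodesFormula (code-▹ ev) d φ →
          CodesFormula ev (node (node (node nil nil) (node nil nil)) (node c d)) (all s φ)

  module _ {Γ : Ctx} (ev : Variables Γ ↣ Code X) where

    mutual
      term-code : ∀ {s} (t : Term Γ s) → ∃[ c ] CodesTerm ev c t
      term-code (var v)    = _ , var refl
      term-code (app f ts) = _ , app refl (proj₂ (terms-code ts))

      terms-code : ∀ {w} (ts : All (Term Γ) w) → ∃[ c ] CodesTerms ev c ts
      terms-code []       = _ , []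
      terms-code (t ∷ ts) = _ , proj₂ (term-code t) ∷ proj₂ (terms-code ts)

    mutual
      term-unique : ∀ {c s s′} {t : Term Γ s} {t′ : Term Γ s′} → CodesTerm ev c t → CodesTerm ev c t′ →
                    _≡_ {A = Σ Sort (Term Γ)} (s , t) (s′ , t′)
      term-unique (var p) (var q) with injective ev (trans (sym p) q)
      ... | refl = refl
      term-unique (app p cs) (app q ds) with injective fun (trans (sym p) q)
      ... | refl with terms-unique cs ds
      ...   | refl = refl

      terms-unique : ∀ {c w} {ts us : All (Term Γ) w} → CodesTerms ev c ts → CodesTerms ev c us → ts ≡ us
      terms-unique []       []       = refl
      terms-unique (c ∷ cs) (d ∷ ds) with term-unique c d | terms-unique cs ds
      ... | refl | refl = refl

  formula-code : ∀ {Γ : Ctx} (ev : Variables Γ ↣ Code X) φ → ∃[ c ] CodesFormula ev c φ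
  formula-code ev ⊥ᶠ         = _ , ⊥ᶠ
  formula-code ev (t ≐ u)    = _ , (proj₂ (term-code ev t) ≐ proj₂ (term-code ev u))
  formula-code ev (rel r ts) = _ , rel refl (proj₂ (terms-code ev ts))
  formula-code ev (φ ∧ ψ)    = _ , (proj₂ (formula-code ev φ) ∧ proj₂ (formula-code ev ψ))
  formula-code ev (φ ⇒ ψ)    = _ , (proj₂ (formula-code ev φ) ⇒ proj₂ (formula-code ev ψ))
  formula-code ev (all s φ)  = _ , all refl (proj₂ (formula-code (code-▹ ev) φ))

  formula-unique : ∀ {Γ : Ctx} (ev : Variables Γ ↣ Code X) {c φ ψ} → CodesFormula ev c φ → CodesFormula ev c ψ → φ ≡ ψ
  formula-unique ev ⊥ᶠ ⊥ᶠ = refl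
  formula-unique ev (c ≐ d) (c′ ≐ d′) with term-unique ev c c′
  ... | refl with term-unique ev d d′
  ...   | refl = refl
  formula-unique ev (rel p cs) (rel q ds) with injective rel′ (trans (sym p) q)
  ... | refl with terms-unique ev cs ds
  ...   | refl = refl
  formula-unique ev (c ∧ d) (c′ ∧ d′) with formula-unique ev c c′ | formula-unique ev d d′
  ... | refl | refl = refl
  formula-unique ev (c ⇒ d) (c′ ⇒ d′) with formula-unique ev c c′ | formula-unique ev d d′
  ... | refl | refl = refl
  formula-unique ev (all p c) (all q d) with injective sort (trans (sym p) q)
  ... | refl with formula-unique (code-▹ ev) c d
  ...   | refl = refl

  code-Formula : ∀ {Γ : Ctx} → Variables Γ ↣ Code X → Formula Γ ↣ Code X
  code-Formula ev = mk↣ {to = λ φ → proj₁ (formula-code ev φ)} λ {φ} {ψ} e →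
    formula-unique ev (subst (λ c → CodesFormula ev c φ) e (proj₂ (formula-code ev φ))) (proj₂ (formula-code ev ψ))

module SymbolCoding (L : Language) where
  open Syntax L

  Symbol : Set
  Symbol = Sort ⊎ ((Σ[ w ∈ List Sort ] Σ[ s ∈ Sort ] Fun w s) ⊎ (Σ[ w ∈ List Sort ] Rel w))

  close : ∀ {Γ : Ctx} w → (∀ {Δ : Ctx} → Ren Γ Δ → All (Term Δ) w → Formula Δ) → Formula Γ
  close []      k = k (λ _ → id) []
  close (s ∷ w) k = all s (close w λ ρ ts → k (λ t → ρ t ∘ inj₁) (var (ρ s (inj₂ refl)) ∷ ts))

  -- Any formula without free variables from which `read` recovers the symbol. As `read` skips
  -- leading quantifiers, a sort is placed behind an implication.
  symbol : Symbol → Formula ⟨ [] ⟩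
  symbol (inj₁ s)                  = ⊥ᶠ ⇒ all s ⊥ᶠ
  symbol (inj₂ (inj₁ (w , s , f))) = close w λ _ ts → app f ts ≐ app f ts
  symbol (inj₂ (inj₂ (w , r)))     = close w λ _ ts → rel r ts

  read : ∀ {Γ : Ctx} → Formula Γ → Maybe Symbol
  read (all s φ)      = read φ
  read (⊥ᶠ ⇒ all s _) = just (inj₁ s)
  read (app f ts ≐ _) = just (inj₂ (inj₁ (_ , _ , f)))
  read (rel r ts)     = just (inj₂ (inj₂ (_ , r)))
  read _              = nothing

  read-close : ∀ {Γ : Ctx} w {k : ∀ {Δ : Ctx} → Ren Γ Δ → All (Term Δ) w → Formula Δ} {x} →
               (∀ {Δ : Ctx} (ρ : Ren Γ Δ) ts → read (k ρ ts) ≡ just x) → read (close w k) ≡ just x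
  read-close []      h = h _ []
  read-close (s ∷ w) h = read-close w λ ρ ts → h _ _

  read-symbol : ∀ x → read (symbol x) ≡ just x
  read-symbol (inj₁ s)                  = refl
  read-symbol (inj₂ (inj₁ (w , s , f))) = read-close w λ _ _ → refl
  read-symbol (inj₂ (inj₂ (w , r)))     = read-close w λ _ _ → refl

  -- The outermost connective tells the three kinds of code apart; the prefix `⊥ᶠ ⇒` gives all atoms
  -- the same one.
  formula : Code Symbol → Formula ⟨ [] ⟩
  formula nil        = ⊥ᶠ
  formula (atom x)   = ⊥ᶠ ⇒ symbol x
  formula (node c d) = formula c ∧ formula d

  formula-injective : ∀ {c d} → formula c ≡ formula d → c ≡ d
  formula-injective {nil}      {nil}      e = refl
  formula-injective {atom x}   {atom y}   e =
    cong atom (just-injective (trans (sym (read-symbol x)) (trans (cong read (conclusion e)) (read-symbol y))))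
    where
    conclusion : ∀ {φ ψ : Formula ⟨ [] ⟩} → ⊥ᶠ ⇒ φ ≡ ⊥ᶠ ⇒ ψ → φ ≡ ψ
    conclusion refl = refl
  formula-injective {node a b} {node c d} e with conjuncts e
    where
    conjuncts : ∀ {φ φ′ ψ ψ′ : Formula ⟨ [] ⟩} → φ ∧ ψ ≡ φ′ ∧ ψ′ → φ ≡ φ′ × ψ ≡ ψ′
    conjuncts refl = refl , refl
  ... | p , q with formula-injective {a} {c} p | formula-injective {b} {d} q
  ...   | refl | refl = refl
  formula-injective {nil}      {atom _}   ()
  formula-injective {nil}      {node _ _} ()
  formula-injective {atom _}   {nil}      ()
  formula-injective {atom _}   {node _ _} ()
  formula-injective {node _ _} {nil}      ()
  formula-injective {node _ _} {atom _}   ()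

  code⇒formula : Code Symbol ↣ FormulasOf L
  code⇒formula = mk↣ {to = λ c → [] , formula c} λ { e → formula-injective (second e) }
    where
    second : ∀ {φ ψ : Formula ⟨ [] ⟩} → _≡_ {A = FormulasOf L} ([] , φ) ([] , ψ) → φ ≡ ψ
    second refl = refl

module ImaginaryCoding (L : Language) (T : Theory L) where
  open SymbolCoding L using (Symbol)
  open Coding {Symbol}
  open Injection using (to; injective)
  module L = Language L

  code-Sort : L.Sort ↣ Code Symbol
  code-Sort = mk↣ {to = λ s → atom (inj₁ s)} λ { refl → refl }

  code-Fun : (Σ[ w ∈ List L.Sort ] Σ[ s ∈ L.Sort ] L.Fun w s) ↣ Code Symbol
  code-Fun = mk↣ {to = λ f → atom (inj₂ (inj₁ f))} λ { refl → refl }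

  code-Rel : (Σ[ w ∈ List L.Sort ] L.Rel w) ↣ Code Symbol
  code-Rel = mk↣ {to = λ r → atom (inj₂ (inj₂ r))} λ { refl → refl }

  module Base = FormulaCoding {Symbol} L code-Sort code-Fun code-Rel
  open Syntax L using (Formula; ⟨_⟩; _⊕_)

  Relation : Set
  Relation = Σ[ w ∈ List L.Sort ] Formula (⟨ w ⟩ ⊕ ⟨ w ⟩)

  code-Relation : Relation ↣ Code Symbol
  code-Relation = code-Σ (code-List code-Sort) (λ w → Base.code-Formula (Base.code-⊕ (code-∈ w) (code-∈ w)))

  -- The proof stored in `quot` is irrelevant, so `w` and `E` determine the sort; imaginaries
  -- therefore add no more than |T| sorts.
  code-EqSort : EqSort L T ↣ Code Symbol
  code-EqSort = mk↣ {to = h} inj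
    where
    h : EqSort L T → Code Symbol
    h (home s)     = atom (inj₁ s)
    h (quot w E e) = node nil (to code-Relation (w , E))
    inj : ∀ {s t} → h s ≡ h t → s ≡ t
    inj {home _}     {home _}        refl = refl
    inj {quot w E _} {quot w′ E′ _} e with injective code-Relation {w , E} {w′ , E′} (nodeʳ e)
    ... | refl = refl
    inj {home _}     {quot _ _ _}    ()
    inj {quot _ _ _} {home _}        ()

  code-EqFun : (Σ[ w ∈ List (EqSort L T) ] Σ[ s ∈ EqSort L T ] EqFun L T w s) ↣ Code Symbol
  code-EqFun = mk↣ {to = h} inj
    where
    h : (Σ[ w ∈ List (EqSort L T) ] Σ[ s ∈ EqSort L T ] EqFun L T w s) → Code Symbol
    h (_ , _ , base f)     = atom (inj₂ (inj₁ (_ , _ , f)))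
    h (_ , _ , proj w E e) = node nil (to code-Relation (w , E))
    inj : ∀ {f g} → h f ≡ h g → f ≡ g
    inj {_ , _ , base _}     {_ , _ , base _}        refl = refl
    inj {_ , _ , proj w E _} {_ , _ , proj w′ E′ _} e with injective code-Relation {w , E} {w′ , E′} (nodeʳ e)
    ... | refl = refl
    inj {_ , _ , base _}     {_ , _ , proj _ _ _}    ()
    inj {_ , _ , proj _ _ _} {_ , _ , base _}        ()

  code-EqRel : (Σ[ w ∈ List (EqSort L T) ] EqRel L T w) ↣ Code Symbol
  code-EqRel = mk↣ {to = h} inj
    where
    h : (Σ[ w ∈ List (EqSort L T) ] EqRel L T w) → Code Symbol
    h (_ , base r) = atom (inj₂ (inj₂ (_ , r)))
    inj : ∀ {r r′} → h r ≡ h r′ → r ≡ r′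
    inj {_ , base _} {_ , base _} refl = refl

  module Eq = FormulaCoding {Symbol} (language^eq L T) code-EqSort code-EqFun code-EqRel

theorem2p1p1 : (∀ {ℓ} → ExcludedMiddle ℓ) →
    (L : Language) (T : Theory L) (complete : Complete L T) →
    (𝒞 : Structure L) (𝒞⊨T : Semantics.Models 𝒞 T) → Types.Monster 𝒞 →
    Rosy complete 𝒞 𝒞⊨T ⇔ LocalCharacter complete 𝒞 𝒞⊨T
theorem2p1p1 em L T complete 𝒞 𝒞⊨T monster =
  mk⇔ (RosyImpliesLocalCharacter.localCharacter em N saturated (FormulasOf L) code)
      (LocalCharacterImpliesRosy.ranksDefined em N saturated (FormulasOf L))
  where
  N : Structure (language^eq L T)
  N = structure^eq complete 𝒞 𝒞⊨T
  saturated : Saturated N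
  saturated = Imaginaries.saturated^eq em complete 𝒞 𝒞⊨T (Types.Monster.saturated monster)
  open Coding
  open SymbolCoding L using (code⇒formula)
  open ImaginaryCoding L T
  open RosyImpliesLocalCharacter em N saturated using (Index)
  code : ∀ x (v : Index x → List (EqSort L T)) → (Σ[ j ∈ Index x ] Σ[ s ∈ EqSort L T ] s ∈ v j) ↣ FormulasOf L
  code x v = code⇒formula ↣-∘ code-Σ
    (code-Σ (code-List code-EqSort) λ y → code-Σ (code-List code-EqSort) λ w →
      code-Σ (code-List (Eq.code-Formula (Eq.code-⊕ (code-∈ x) (code-∈ y)))) λ _ →
      code-Σ (code-List (Eq.code-Formula (Eq.code-⊕ (code-∈ y) (code-∈ w)))) λ _ → code-ℕ)
    (λ j → code-∈ (v j))
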